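{- Let $p$ be a prime number and $R\cong\mathbb Z_p\times\mathbb Z_p\times\mathbb Z_p$. Put $$\lambda_{1,2} = \tfrac12\big(1-p\pm(p-1)\sqrt{4p-3}\big),\qquad \lambda_{3,4} = p-1\pm\sqrt{p-2p^2+p^3}.$$ Then the spectrum (multiset of eigenvalues) of the zero-divisor graph $\Gamma(R)$ is $$\operatorname{spec}(\Gamma(R)) = \big\{\lambda_1^{[2]},\lambda_2^{[2]},\lambda_3^{[1]},\lambda_4^{[1]},0^{[3(p+1)(p-2)]}\big\}.$$
   Context: $\mathbb Z_p$ denotes the ring of integers modulo $p$. For a finite commutative ring $R$ with $1\ne0$, the zero-divisor graph $\Gamma(R)$ has as vertex set the set of non-zero zero-divisors of $R$, and two (not necessarily distinct) vertices $x,y$ are adjacent iff $xy=0$ (loops are kept). The spectrum of a graph is the multiset of eigenvalues of its adjacency matrix; $\lambda^{[m]}$ means that $\lambda$ occurs with multiplicity $m$ (and $0^{[0]}$ means that $0$ does not occur). -}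

module Defs where

open import Algebra.Apartness.Bundles using (HeytingField; HeytingCommutativeRing)
open import Algebra.Bundles using (CommutativeRing; Semiring)
import Algebra.Construct.DirectProduct as DirectProduct
open import Algebra.Morphism.Structures using (module RingMorphisms)
import Algebra.Definitions.RawSemiring as RawSemiringDefs
open import Data.Bool.Base using (if_then_else_)
open import Data.Fin.Base using (Fin; zero; suc; toℕ; punchIn)
import Data.Fin.Properties as Fin
open import Data.Integer.Base as ℤ using (ℤ; +_)
open import Data.Integer.Divisibility.Signed using (_∣_; divides; ∣m⇒∣-m; ∣m∣n⇒∣m+n; ∣m⇒∣m*n; ∣n⇒∣m*n)
import Data.Integer.Properties as ℤ
open import Data.Integer.Tactic.RingSolver using (solve-∀)
open import Data.List.Base using (List; foldr; filter; length; lookup; map)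
open import Data.List.Relation.Unary.Any as Any using (any?)
open import Data.List.Relation.Unary.Enumerates.Setoid using (IsEnumeration)
open import Data.List.Relation.Unary.Unique.Setoid using (Unique)
open import Data.Nat.Base using (ℕ; zero; suc)
open import Data.Product.Base using (∃-syntax; _,_; proj₁; proj₂; _×_)
open import Data.Sum.Base using (_⊎_; inj₁; inj₂)
open import Function.Base using (_∘_)
open import Level using (Level; _⊔_) renaming (suc to lsuc)
open import Relation.Binary.Core using (Rel)
open import Relation.Binary.Definitions using (Decidable; Symmetric)
open import Relation.Binary.PropositionalEquality.Core as ≡ using (_≡_)
open import Relation.Binary.Structures using (IsStrictPartialOrder)
open import Relation.Nullary.Decidable.Core using (Dec; does; map′; ¬?; _×-dec_)
open import Relation.Nullary.Negation.Core using (¬_)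

private
  variable
    a b k ℓ ℓ₁ ℓ₂ ℓ₃ : Level

------------------------------------------------------------------------
-- Ordered fields with square roots

-- The library has no real numbers.  This structure collects what is needed to
-- read the eigenvalue formulas; ℝ satisfies it, both classically and
-- constructively (hence the apartness relation and the definition of _≤_ as a
-- negation).

record EuclideanField k ℓ₁ ℓ₂ ℓ₃ : Set (lsuc (k ⊔ ℓ₁ ⊔ ℓ₂ ⊔ ℓ₃)) where
  infix  4 _<_ _≤_
  field
    heytingField : HeytingField k ℓ₁ ℓ₂

  open HeytingField heytingField public

  field
    _<_                  : Rel Carrier ℓ₃
    isStrictPartialOrder : IsStrictPartialOrder _≈_ _<_
    #⇒<⊎>                : ∀ {x y} → x # y → x < y ⊎ y < x
    <⇒#                  : ∀ {x y} → x < y → x # y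
    +-monoʳ-<            : ∀ x {y z} → y < z → x + y < x + z
    *-pos                : ∀ {x y} → 0# < x → 0# < y → 0# < x * y

  _≤_ : Rel Carrier ℓ₃
  x ≤ y = ¬ (y < x)

  -- √ is total; its values at negative arguments are unspecified.
  field
    √        : Carrier → Carrier
    √-cong   : ∀ {x y} → x ≈ y → √ x ≈ √ y
    √-nonNeg : ∀ {x} → 0# ≤ x → 0# ≤ √ x
    √-square : ∀ {x} → 0# ≤ x → √ x * √ x ≈ x

  module < = IsStrictPartialOrder isStrictPartialOrder

  commutativeRing : CommutativeRing k ℓ₁
  commutativeRing =
    HeytingCommutativeRing.commutativeRing (HeytingField.heytingCommutativeRing heytingField)

  open CommutativeRing commutativeRing public using (ring; semiring)
  open RawSemiringDefs (Semiring.rawSemiring semiring) public using (_^_) renaming (_×_ to _×ℕ_)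
  open import Algebra.Properties.Ring ring using (-‿distribˡ-*; -‿involutive; -0#≈0#)

  fromℕ : ℕ → Carrier
  fromℕ n = n ×ℕ 1#

  1#0 : 1# # 0#
  1#0 = invertible⇒# (1# , 1*[1-0]≈1 , trans (*-comm _ _) 1*[1-0]≈1)
    where
    1*[1-0]≈1 : 1# * (1# - 0#) ≈ 1#
    1*[1-0]≈1 = trans (*-identityˡ _) (trans (+-congˡ -0#≈0#) (+-identityʳ 1#))

  0<1 : 0# < 1#
  0<1 with #⇒<⊎> 1#0
  ... | inj₂ 0<1 = 0<1
  ... | inj₁ 1<0 = <.<-respʳ-≈ [-1]²≈1 (*-pos 0<-1 0<-1)
    where
    0<-1 : 0# < - 1#
    0<-1 = <.<-respʳ-≈ (+-identityʳ _) (<.<-respˡ-≈ (-‿inverseˡ 1#) (+-monoʳ-< (- 1#) 1<0))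
    [-1]²≈1 : - 1# * - 1# ≈ 1#
    [-1]²≈1 = trans (sym (-‿distribˡ-* 1# (- 1#)))
                    (trans (-‿cong (*-identityˡ _)) (-‿involutive 1#))

  2#0 : fromℕ 2 # 0#
  2#0 = #-sym (<⇒# (<.trans 0<1 1<2))
    where
    1<2 : 1# < fromℕ 2
    1<2 = <.<-respʳ-≈ (+-congˡ (sym (+-identityʳ 1#)))
                      (<.<-respˡ-≈ (+-identityʳ 1#) (+-monoʳ-< 1# 0<1))

  ½ : Carrier
  ½ = proj₁ (#⇒invertible 2#0)

  ½*2≈1 : ½ * fromℕ 2 ≈ 1#
  ½*2≈1 = trans (*-congˡ (sym (trans (+-congˡ -0#≈0#) (+-identityʳ _))))
                (proj₁ (proj₂ (#⇒invertible 2#0)))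

------------------------------------------------------------------------
-- Matrices

module _ (K : CommutativeRing k ℓ) where
  open CommutativeRing K hiding (zero)
  open RawSemiringDefs (Semiring.rawSemiring semiring) using (_^_; sum)

  Matrix : ℕ → Set k
  Matrix n = Fin n → Fin n → Carrier

  -- Laplace expansion along the first row.
  det : ∀ {n} → Matrix n → Carrier
  det {zero}  M = 1#
  det {suc n} M =
    sum λ j → (- 1#) ^ toℕ j * M zero j * det λ i l → M (suc i) (punchIn j l)

  identity : ∀ {n} → Matrix n
  identity i j = if does (i Fin.≟ j) then 1# else 0#

  -- The characteristic polynomial det (x I − M), as a function of x.
  charPoly : ∀ {n} → Matrix n → Carrier → Carrier
  charPoly M x = det λ i j → x * identity i j - M i j

------------------------------------------------------------------------
-- Graphs and their spectra

-- Loops are allowed, multiple edges are not.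
record FiniteGraph ℓ : Set (lsuc ℓ) where
  infix 4 _~_ _~?_
  field
    order : ℕ
    _~_   : Rel (Fin order) ℓ
    ~-sym : Symmetric _~_
    _~?_  : Decidable _~_

module Spectrum (K : EuclideanField k ℓ₁ ℓ₂ ℓ₃) where
  open EuclideanField K

  adjacencyMatrix : (G : FiniteGraph ℓ) → Matrix commutativeRing (FiniteGraph.order G)
  adjacencyMatrix G i j = if does (i ~? j) then 1# else 0#
    where open FiniteGraph G

  -- The multiset of eigenvalues, each counted with its multiplicity as a root
  -- of the characteristic polynomial, consists of the entries of λs.  An
  -- ordered field is infinite, so it suffices to compare the polynomials
  -- det (x I − A) and ∏ (x − λ) as functions of x.
  HasSpectrum : FiniteGraph ℓ → List Carrier → Set (k ⊔ ℓ₁)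
  HasSpectrum G λs = ∀ x →
    charPoly commutativeRing (adjacencyMatrix G) x ≈ foldr _*_ 1# (map (λ a → x - a) λs)

------------------------------------------------------------------------
-- Finite commutative rings and zero-divisor graphs

record FiniteCommutativeRing c ℓ : Set (lsuc (c ⊔ ℓ)) where
  field
    commutativeRing : CommutativeRing c ℓ

  open CommutativeRing commutativeRing public

  infix 4 _≟_
  field
    _≟_         : Decidable _≈_
    elements    : List Carrier
    enumeration : IsEnumeration setoid elements
    unique      : Unique setoid elements
    1≉0         : ¬ (1# ≈ 0#)

module _ (R : FiniteCommutativeRing a ℓ) where
  open FiniteCommutativeRing R

  IsZeroDivisor : Carrier → Set (a ⊔ ℓ)
  IsZeroDivisor x = ∃[ y ] ¬ (y ≈ 0#) × x * y ≈ 0#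

  isZeroDivisor? : ∀ x → Dec (IsZeroDivisor x)
  isZeroDivisor? x =
    map′ Any.satisfied
         (λ (y , y≉0 , xy≈0) → Any.map (λ y≈z → (λ z≈0 → y≉0 (trans y≈z z≈0))
                                              , trans (*-congˡ (sym y≈z)) xy≈0)
                                       (enumeration y))
         (any? (λ y → ¬? (y ≟ 0#) ×-dec (x * y ≟ 0#)) elements)

  nonzeroZeroDivisors : List Carrier
  nonzeroZeroDivisors = filter (λ x → ¬? (x ≟ 0#) ×-dec isZeroDivisor? x) elements

  -- The vertices are numbered by their position in nonzeroZeroDivisors.
  Γ : FiniteGraph ℓ
  Γ = record
    { order = length nonzeroZeroDivisors
    ; _~_   = λ i j → vertex i * vertex j ≈ 0#
    ; ~-sym = λ xy≈0 → trans (*-comm _ _) xy≈0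
    ; _~?_  = λ i j → vertex i * vertex j ≟ 0#
    }
    where
    vertex : Fin (length nonzeroZeroDivisors) → Carrier
    vertex = lookup nonzeroZeroDivisors

------------------------------------------------------------------------
-- Ring isomorphisms, products, and the integers modulo n

infix 4 _≅_
_≅_ : CommutativeRing a ℓ₁ → CommutativeRing b ℓ₂ → Set (a ⊔ b ⊔ ℓ₁ ⊔ ℓ₂)
R ≅ S = ∃[ f ] IsRingIsomorphism f
  where open RingMorphisms (CommutativeRing.rawRing R) (CommutativeRing.rawRing S)

infixr 7 _⊗_
_⊗_ : CommutativeRing a ℓ₁ → CommutativeRing b ℓ₂ → CommutativeRing (a ⊔ b) (ℓ₁ ⊔ ℓ₂)
_⊗_ = DirectProduct.commutativeRing

-- The quotient ℤ / n ℤ as a setoid on ℤ.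
module _ (n : ℕ) where
  infix 4 _≡ₙ_
  _≡ₙ_ : Rel ℤ _
  x ≡ₙ y = + n ∣ x ℤ.- y

  private
    reflexive : ∀ {x y} → x ≡ y → x ≡ₙ y
    reflexive {x} ≡.refl = divides ℤ.0ℤ (ℤ.+-inverseʳ x)

    symmetric : ∀ {x y} → x ≡ₙ y → y ≡ₙ x
    symmetric {x} {y} p = ≡.subst (+ n ∣_) (lemma x y) (∣m⇒∣-m p)
      where
      lemma : ∀ x y → ℤ.- (x ℤ.- y) ≡ y ℤ.- x
      lemma = solve-∀

    transitive : ∀ {x y z} → x ≡ₙ y → y ≡ₙ z → x ≡ₙ z
    transitive {x} {y} {z} p q = ≡.subst (+ n ∣_) (lemma x y z) (∣m∣n⇒∣m+n p q)
      where
      lemma : ∀ x y z → (x ℤ.- y) ℤ.+ (y ℤ.- z) ≡ x ℤ.- z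
      lemma = solve-∀

    +-cong : ∀ {x y u v} → x ≡ₙ y → u ≡ₙ v → x ℤ.+ u ≡ₙ y ℤ.+ v
    +-cong {x} {y} {u} {v} p q = ≡.subst (+ n ∣_) (lemma x y u v) (∣m∣n⇒∣m+n p q)
      where
      lemma : ∀ x y u v → (x ℤ.- y) ℤ.+ (u ℤ.- v) ≡ (x ℤ.+ u) ℤ.- (y ℤ.+ v)
      lemma = solve-∀

    *-cong : ∀ {x y u v} → x ≡ₙ y → u ≡ₙ v → x ℤ.* u ≡ₙ y ℤ.* v
    *-cong {x} {y} {u} {v} p q =
      ≡.subst (+ n ∣_) (lemma x y u v) (∣m∣n⇒∣m+n (∣m⇒∣m*n u p) (∣n⇒∣m*n y q))
      where
      lemma : ∀ x y u v → (x ℤ.- y) ℤ.* u ℤ.+ y ℤ.* (u ℤ.- v) ≡ x ℤ.* u ℤ.- y ℤ.* v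
      lemma = solve-∀

    -‿cong : ∀ {x y} → x ≡ₙ y → ℤ.- x ≡ₙ ℤ.- y
    -‿cong {x} {y} p = ≡.subst (+ n ∣_) (lemma x y) (∣m⇒∣-m p)
      where
      lemma : ∀ x y → ℤ.- (x ℤ.- y) ≡ ℤ.- x ℤ.- ℤ.- y
      lemma = solve-∀

  ℤ/ : CommutativeRing _ _
  ℤ/ = record
    { Carrier = ℤ
    ; _≈_ = _≡ₙ_
    ; _+_ = ℤ._+_
    ; _*_ = ℤ._*_
    ; -_  = ℤ.-_
    ; 0#  = ℤ.0ℤ
    ; 1#  = ℤ.1ℤ
    ; isCommutativeRing = record
      { isRing = record
        { +-isAbelianGroup = record
          { isGroup = record
            { isMonoid = record
              { isSemigroup = record
                { isMagma = record
                  { isEquivalence = record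
                    { refl  = λ {x} → reflexive {x} ≡.refl
                    ; sym   = λ {x} {y} → symmetric {x} {y}
                    ; trans = λ {x} {y} {z} → transitive {x} {y} {z}
                    }
                  ; ∙-cong = λ {x} {y} {u} {v} → +-cong {x} {y} {u} {v}
                  }
                ; assoc = λ x y z → reflexive (ℤ.+-assoc x y z)
                }
              ; identity = reflexive ∘ ℤ.+-identityˡ , reflexive ∘ ℤ.+-identityʳ
              }
            ; inverse = reflexive ∘ ℤ.+-inverseˡ , reflexive ∘ ℤ.+-inverseʳ
            ; ⁻¹-cong = λ {x} {y} → -‿cong {x} {y}
            }
          ; comm = λ x y → reflexive (ℤ.+-comm x y)
          }
        ; *-cong = λ {x} {y} {u} {v} → *-cong {x} {y} {u} {v}
        ; *-assoc = λ x y z → reflexive (ℤ.*-assoc x y z)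
        ; *-identity = reflexive ∘ ℤ.*-identityˡ , reflexive ∘ ℤ.*-identityʳ
        ; distrib = (λ x y z → reflexive (ℤ.*-distribˡ-+ x y z))
                  , (λ x y z → reflexive (ℤ.*-distribʳ-+ x y z))
        }
      ; *-comm = λ x y → reflexive (ℤ.*-comm x y)
      }
    }

{-# OPTIONS --safe #-}
module Submission where

-- Write q = p − 1.  The adjacency of two vertices of Γ(R) depends only on their
-- supports in ℤₚ³, so vertices with the same support are twins.  More generally
-- let vertex i carry a weight wᵢ, which multiplies row i of the adjacency
-- matrix.  Replacing twins of weights v and w by one vertex of weight v + w
-- divides the determinant of x I − W A by x.  This leaves six vertices, the
-- proper nonempty supports, of weights q, q, q, q², q², q²; their determinant is
-- (x² − 2qx − q³)(x² + qx − q³)².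

open import Defs
open import Data.List.Base using (List; replicate; _++_)
open import Data.Nat.Base as ℕ using (ℕ; _∸_)
open import Data.Nat.Primality using (Prime)
open import Level using (Level)

open import Algebra.Bundles using (CommutativeRing; Semiring)
import Algebra.Definitions.RawSemiring as RawSemiringDefs
open import Algebra.Morphism.Structures using (module RingMorphisms)
import Algebra.Properties.AbelianGroup as AbelianGroupProperties
import Algebra.Properties.Monoid.Mult.TCOptimised as MonoidMult
import Algebra.Properties.Ring as RingProperties
import Algebra.Properties.Semiring.Exp as Exp
import Algebra.Properties.Semiring.Mult as SemiringMult
import Algebra.Properties.Semiring.Mult.TCOptimised as Mult
import Algebra.Properties.Semiring.Sum as SemiringSum
import Algebra.Solver.Ring as RingSolver
open import Algebra.Solver.Ring.AlmostCommutativeRing using (fromCommutativeRing; _-Raw-AlmostCommutative⟶_)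
open import Data.Bool.Base using (Bool; true; false; if_then_else_; _∧_; not)
open import Data.Fin.Base using (Fin; zero; suc; toℕ; fromℕ<; punchIn; cast)
open import Data.Fin.Patterns using (0F; 1F; 2F; 3F; 4F; 5F)
open import Data.Fin.Permutation using (Permutation; _⟨$⟩ʳ_; _⟨$⟩ˡ_; inverseˡ; cast-id; ↔⇒≡)
open import Data.Fin.Permutation.Components using (transpose)
open import Data.Fin.Permutation.Transposition.List using (TranspositionList; eval; decompose; eval-decompose)
import Data.Fin.Properties as Fin
open import Data.Integer.Base as ℤ using (ℤ; +_; -[1+_]; 0ℤ; _%ℕ_; _/ℕ_; ∣_∣)
open import Data.Integer.DivMod using (n%ℕd<d; a≡a%ℕn+[a/ℕn]*n)
open import Data.Integer.Divisibility.Signed using (_∣_; divides; ∣⇒∣ᵤ; ∣ᵤ⇒∣; ∣m⇒∣m*n; ∣n⇒∣m*n)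
import Data.Integer.Properties as ℤ
open import Data.Integer.Tactic.RingSolver using (solve-∀)
open import Data.List.Base
  using ([]; _∷_; length; lookup; map; concatMap; foldr; cartesianProduct; allFin)
open import Data.List.Membership.Propositional using (_∈_)
open import Data.List.Membership.Propositional.Properties
  using (∈-map⁺; ∈-map⁻; ∈-cartesianProduct⁺; ∈-cartesianProduct⁻; ∈-concat⁺′; ∈-concat⁻′; ∈-allFin)
open import Data.List.Membership.Propositional.Properties.WithK using (unique∧set⇒bag)
import Data.List.Membership.Setoid.Properties as SetoidMembership
import Data.List.Properties as List
open import Data.List.Relation.Binary.BagAndSetEquality using (∼bag⇒↭)
open import Data.List.Relation.Binary.Disjoint.Propositional using (Disjoint)
open import Data.List.Relation.Binary.Permutation.Propositional as ↭ using (_↭_; ↭⇒↭ₛ)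
open import Data.List.Relation.Binary.Permutation.Propositional.Properties using (∷↭∷ʳ) renaming (map⁺ to ↭-map⁺)
open import Data.List.Relation.Binary.Permutation.Setoid using (onIndices)
open import Data.List.Relation.Binary.Permutation.Setoid.Properties using (onIndices-lookup)
open import Data.List.Relation.Unary.All as All using ()
import Data.List.Relation.Unary.All.Properties as All
open import Data.List.Relation.Unary.AllPairs as AllPairs using ()
import Data.List.Relation.Unary.AllPairs.Properties as AllPairs
open import Data.List.Relation.Unary.Any using (here; there)
open import Data.List.Relation.Unary.Unique.Propositional using (Unique)
import Data.List.Relation.Unary.Unique.Propositional.Properties as Unique
import Data.List.Relation.Unary.Unique.Setoid.Properties as SetoidUnique
open import Data.Maybe.Base using (Maybe; just; nothing)
open import Data.Nat.Base using (zero; suc)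
import Data.Nat.Divisibility as ℕ
import Data.Nat.DivMod as ℕ
open import Data.Nat.ListAction using () renaming (sum to sumℕ)
open import Data.Nat.Primality using (euclidsLemma; prime⇒nonTrivial)
import Data.Nat.Properties as ℕ
open import Data.Nat.Tactic.RingSolver using () renaming (solve-∀ to solveℕ-∀)
open import Data.Product.Base using (_,_; proj₁; proj₂; _×_; ∃-syntax)
open import Data.Sum.Base using (_⊎_; inj₁; inj₂)
open import Data.Vec.Base as Vec using ()
open import Data.Vec.Functional as Vector using (Vector; updateAt)
open import Data.Vec.Functional.Properties using (updateAt-updates; updateAt-minimal; updateAt-commutes)
open import Function.Base using (_∘_; const; _$_; id)
open import Function.Bundles using (mk⇔; _⇔_; Equivalence)
open import Relation.Binary.PropositionalEquality.Core as ≡ using (_≡_; _≢_)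
import Relation.Binary.PropositionalEquality.Properties as ≡
import Relation.Binary.Reasoning.Setoid as SetoidReasoning
open import Relation.Nullary.Decidable
  using (Dec; yes; no; does; dec-true; dec-false; does-⇔; ¬?; _×-dec_)
open import Relation.Nullary.Negation using (¬_; contradiction)

-- A spectrum is a statement about the value of det (x I - A) at every x, zero and the eigenvalues
-- included, so the reduction may neither divide by x nor invert a block. Merging is therefore an
-- identity det = x · det′ over an arbitrary commutative ring. Keeping the weights in the rows,
-- apart from the adjacency, is what makes a merged list an instance of the same construction, so
-- that merging can be iterated.
--
-- The vertices come in whatever order the enumeration of R has, and R has only a setoid equality.
-- They are matched with a canonical list of triples in `Fin p`, grouped by support. The match is
-- only a permutation, so the determinant must be invariant under a simultaneous permutation of rows
-- and columns, and this rests on an alternation property that has to be extracted from the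
-- expansion along the first row.

private
  variable
    a b c k ℓ ℓ₁ ℓ₂ ℓ₃ : Level

-- Polynomial identities over a commutative ring, with integer coefficients

module IntegerSolver (K : CommutativeRing k ℓ) where
  open CommutativeRing K hiding (zero)
  open RingProperties ring
  open AbelianGroupProperties +-abelianGroup using (⁻¹-∙-comm; ⁻¹-involutive; ε⁻¹≈ε)
  open Mult semiring using (×1-homo-*)
  open MonoidMult +-monoid using (×-homo-+; 1+×)
  open RawSemiringDefs (Semiring.rawSemiring semiring) using () renaming (_×′_ to _×ᵗ_)
  open SetoidReasoning setoid

  -- The optimised multiple makes ⟦ + 0 ⟧ and ⟦ + 1 ⟧ compute to 0# and 1#.
  ⟦_⟧ : ℤ → Carrier
  ⟦ + n ⟧      = n ×ᵗ 1#
  ⟦ -[1+ n ] ⟧ = - (suc n ×ᵗ 1#)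

  private
    cancel : ∀ u v w → (u + v) - (u + w) ≈ v - w
    cancel u v w = begin
      (u + v) - (u + w)     ≈⟨ +-cong (+-comm v u) (⁻¹-∙-comm u w) ⟨
      (v + u) + (- u - w)   ≈⟨ +-assoc v u _ ⟩
      v + (u + (- u - w))   ≈⟨ +-congˡ (+-assoc u (- u) _) ⟨
      v + ((u - u) - w)     ≈⟨ +-congˡ (+-congʳ (-‿inverseʳ u)) ⟩
      v + (0# - w)          ≈⟨ +-congˡ (+-identityˡ _) ⟩
      v - w                 ∎

    ⊖-homo : ∀ m n → ⟦ m ℤ.⊖ n ⟧ ≈ m ×ᵗ 1# - n ×ᵗ 1#
    ⊖-homo zero    zero    = sym (-‿inverseʳ 0#)
    ⊖-homo zero    (suc n) = sym (+-identityˡ _)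
    ⊖-homo (suc m) zero    = sym (trans (+-congˡ ε⁻¹≈ε) (+-identityʳ _))
    ⊖-homo (suc m) (suc n) = begin
      ⟦ suc m ℤ.⊖ suc n ⟧                   ≡⟨ ≡.cong ⟦_⟧ (ℤ.[1+m]⊖[1+n]≡m⊖n m n) ⟩
      ⟦ m ℤ.⊖ n ⟧                           ≈⟨ ⊖-homo m n ⟩
      m ×ᵗ 1# - n ×ᵗ 1#                     ≈⟨ cancel 1# _ _ ⟨
      (1# + m ×ᵗ 1#) - (1# + n ×ᵗ 1#)       ≈⟨ +-cong (1+× m 1#) (-‿cong (1+× n 1#)) ⟨
      suc m ×ᵗ 1# - suc n ×ᵗ 1#             ∎

    neg-homo : ∀ n → ⟦ ℤ.- (+ n) ⟧ ≈ - (n ×ᵗ 1#)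
    neg-homo zero    = sym ε⁻¹≈ε
    neg-homo (suc n) = refl

    +-homo : ∀ i j → ⟦ i ℤ.+ j ⟧ ≈ ⟦ i ⟧ + ⟦ j ⟧
    +-homo (+ m)    (+ n)    = ×-homo-+ 1# m n
    +-homo (+ m)    -[1+ n ] = ⊖-homo m (suc n)
    +-homo -[1+ m ] (+ n)    = trans (⊖-homo n (suc m)) (+-comm _ _)
    +-homo -[1+ m ] -[1+ n ] = begin
      - (suc (suc (m ℕ.+ n)) ×ᵗ 1#)            ≡⟨ ≡.cong (λ l → - (l ×ᵗ 1#)) (≡.cong suc (ℕ.+-suc m n)) ⟨
      - ((suc m ℕ.+ suc n) ×ᵗ 1#)              ≈⟨ -‿cong (×-homo-+ 1# (suc m) (suc n)) ⟩
      - (suc m ×ᵗ 1# + suc n ×ᵗ 1#)            ≈⟨ ⁻¹-∙-comm _ _ ⟨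
      - (suc m ×ᵗ 1#) - suc n ×ᵗ 1#            ∎

    -‿homo : ∀ i → ⟦ ℤ.- i ⟧ ≈ - ⟦ i ⟧
    -‿homo (+ n)    = neg-homo n
    -‿homo -[1+ n ] = sym (⁻¹-involutive _)

    *-homo⁺ : ∀ m n → ⟦ + m ℤ.* + n ⟧ ≈ m ×ᵗ 1# * (n ×ᵗ 1#)
    *-homo⁺ m n = begin
      ⟦ + m ℤ.* + n ⟧    ≡⟨ ≡.cong ⟦_⟧ (ℤ.pos-* m n) ⟨
      (m ℕ.* n) ×ᵗ 1#    ≈⟨ ×1-homo-* m n ⟩
      m ×ᵗ 1# * (n ×ᵗ 1#) ∎

    *-homo : ∀ i j → ⟦ i ℤ.* j ⟧ ≈ ⟦ i ⟧ * ⟦ j ⟧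
    *-homo (+ m)    (+ n)    = *-homo⁺ m n
    *-homo (+ m)    -[1+ n ] = begin
      ⟦ + m ℤ.* -[1+ n ] ⟧             ≡⟨ ≡.cong ⟦_⟧ (ℤ.neg-distribʳ-* (+ m) (+ suc n)) ⟨
      ⟦ ℤ.- (+ m ℤ.* + suc n) ⟧        ≈⟨ -‿homo (+ m ℤ.* + suc n) ⟩
      - ⟦ + m ℤ.* + suc n ⟧            ≈⟨ -‿cong (*-homo⁺ m (suc n)) ⟩
      - (m ×ᵗ 1# * (suc n ×ᵗ 1#))      ≈⟨ -‿distribʳ-* _ _ ⟩
      m ×ᵗ 1# * - (suc n ×ᵗ 1#)        ∎
    *-homo -[1+ m ] (+ n)    = begin
      ⟦ -[1+ m ] ℤ.* + n ⟧             ≡⟨ ≡.cong ⟦_⟧ (ℤ.neg-distribˡ-* (+ suc m) (+ n)) ⟨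
      ⟦ ℤ.- (+ suc m ℤ.* + n) ⟧        ≈⟨ -‿homo (+ suc m ℤ.* + n) ⟩
      - ⟦ + suc m ℤ.* + n ⟧            ≈⟨ -‿cong (*-homo⁺ (suc m) n) ⟩
      - (suc m ×ᵗ 1# * (n ×ᵗ 1#))      ≈⟨ -‿distribˡ-* _ _ ⟩
      - (suc m ×ᵗ 1#) * (n ×ᵗ 1#)      ∎
    *-homo -[1+ m ] -[1+ n ] = begin
      (suc m ℕ.* suc n) ×ᵗ 1#              ≈⟨ ×1-homo-* (suc m) (suc n) ⟩
      suc m ×ᵗ 1# * (suc n ×ᵗ 1#)          ≈⟨ ⁻¹-involutive _ ⟨
      - - (suc m ×ᵗ 1# * (suc n ×ᵗ 1#))    ≈⟨ -‿cong (-‿distribʳ-* _ _) ⟩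
      - (suc m ×ᵗ 1# * - (suc n ×ᵗ 1#))    ≈⟨ -‿distribˡ-* _ _ ⟩
      - (suc m ×ᵗ 1#) * - (suc n ×ᵗ 1#)    ∎

    morphism : ℤ.+-*-rawRing -Raw-AlmostCommutative⟶ fromCommutativeRing K
    morphism = record
      { ⟦_⟧    = ⟦_⟧
      ; +-homo = +-homo
      ; *-homo = *-homo
      ; -‿homo = -‿homo
      ; 0-homo = refl
      ; 1-homo = refl
      }

    -- Equality in `K` need not be decidable, so coefficients are compared as integers. The answer
    -- `nothing` costs only completeness: distinct integers may still agree in `K`.
    _coeff≟_ : ∀ i j → Maybe (⟦ i ⟧ ≈ ⟦ j ⟧)
    i coeff≟ j with i ℤ.≟ j
    ... | yes i≡j = just (reflexive (≡.cong ⟦_⟧ i≡j))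
    ... | no  _   = nothing

  open RingSolver ℤ.+-*-rawRing (fromCommutativeRing K) morphism _coeff≟_ public
    using (Polynomial; con; var; prove; solve; _:=_; _:+_; _:*_; _:-_; :-_)

  0ₚ 1ₚ : ∀ {n} → Polynomial n
  0ₚ = con (+ 0)
  1ₚ = con (+ 1)

-- Determinants over a commutative ring

module Determinant (K : CommutativeRing k ℓ) where
  open CommutativeRing K hiding (zero)
  open RawSemiringDefs (Semiring.rawSemiring semiring) using (_^_; sum)
  open SemiringSum semiring using (*-distribˡ-sum; sum-cong-≋; ∑-distrib-+; ∑-comm; sum-replicate-zero)
  open RingProperties ring
  open IntegerSolver K
  open SetoidReasoning setoid

  private
    variable
      m n : ℕ

    sum-zero : {t : Vector Carrier n} → (∀ i → t i ≈ 0#) → sum t ≈ 0#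
    sum-zero {n} t≈0 = trans (sum-cong-≋ t≈0) (sum-replicate-zero n)

    minor : Matrix K (suc n) → Fin (suc n) → Matrix K n
    minor M j i l = M (suc i) (punchIn j l)

  det-cong : {M N : Matrix K n} → (∀ i j → M i j ≈ N i j) → det K M ≈ det K N
  det-cong {zero}  M≈N = refl
  det-cong {suc n} M≈N = sum-cong-≋ λ j →
    *-cong (*-congˡ {(- 1#) ^ toℕ j} (M≈N zero j)) (det-cong λ i l → M≈N (suc i) (punchIn j l))

  -- In the first-row expansion, linearity in row zero sits in the entries and linearity in a later
  -- row sits in the minors, whence the recursion on `r`. Additivity and homogeneity are bundled
  -- because each row of x I - W A is a combination of a unit row and an adjacency row.
  det-linear : (r : Fin n) {L M N : Matrix K n} (u v : Carrier) →
               (∀ j → L r j ≈ u * M r j + v * N r j) →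
               (∀ i → i ≢ r → ∀ j → L i j ≈ M i j) →
               (∀ i → i ≢ r → ∀ j → L i j ≈ N i j) →
               det K L ≈ u * det K M + v * det K N
  det-linear {suc n} r {L} {M} {N} u v L≈ L≈M L≈N = begin
    det K L
      ≈⟨ sum-cong-≋ {suc n} (term r L≈ L≈M L≈N) ⟩
    sum {suc n} (λ j → u * t M j + v * t N j)
      ≈⟨ ∑-distrib-+ (λ j → u * t M j) (λ j → v * t N j) ⟩
    sum {suc n} (λ j → u * t M j) + sum {suc n} (λ j → v * t N j)
      ≈⟨ +-cong (*-distribˡ-sum u (t M)) (*-distribˡ-sum v (t N)) ⟨
    u * det K M + v * det K N ∎
    where
    t : Matrix K (suc n) → Fin (suc n) → Carrier
    t M j = (- 1#) ^ toℕ j * M zero j * det K (minor M j)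

    term : ∀ r → (∀ j → L r j ≈ u * M r j + v * N r j) →
           (∀ i → i ≢ r → ∀ j → L i j ≈ M i j) →
           (∀ i → i ≢ r → ∀ j → L i j ≈ N i j) →
           ∀ j → t L j ≈ u * t M j + v * t N j
    term zero L≈ L≈M L≈N j = begin
      s * L zero j * det K (minor L j)
        ≈⟨ *-congʳ (*-congˡ (L≈ j)) ⟩
      s * (u * M zero j + v * N zero j) * det K (minor L j)
        ≈⟨ solve 6 (λ s u v m n d → s :* (u :* m :+ v :* n) :* d
                     := u :* (s :* m :* d) :+ v :* (s :* n :* d)) refl s u v _ _ _ ⟩
      u * (s * M zero j * det K (minor L j)) + v * (s * N zero j * det K (minor L j))
        ≈⟨ +-cong (*-congˡ (*-congˡ (det-cong λ i l → L≈M (suc i) (λ ()) (punchIn j l))))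
                  (*-congˡ (*-congˡ (det-cong λ i l → L≈N (suc i) (λ ()) (punchIn j l)))) ⟩
      u * t M j + v * t N j ∎
      where s = (- 1#) ^ toℕ j
    term (suc r) L≈ L≈M L≈N j = begin
      s * L zero j * det K (minor L j)
        ≈⟨ *-congˡ (det-linear r u v (λ l → L≈ (punchIn j l))
             (λ i i≢r l → L≈M (suc i) (i≢r ∘ Fin.suc-injective) (punchIn j l))
             (λ i i≢r l → L≈N (suc i) (i≢r ∘ Fin.suc-injective) (punchIn j l))) ⟩
      s * L zero j * (u * det K (minor M j) + v * det K (minor N j))
        ≈⟨ solve 6 (λ s l u v m n → s :* l :* (u :* m :+ v :* n)
                     := u :* (s :* l :* m) :+ v :* (s :* l :* n)) refl s _ u v _ _ ⟩
      u * (s * L zero j * det K (minor M j)) + v * (s * L zero j * det K (minor N j))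
        ≈⟨ +-cong (*-congˡ (*-congʳ (*-congˡ (L≈M zero (λ ()) j))))
                  (*-congˡ (*-congʳ (*-congˡ (L≈N zero (λ ()) j)))) ⟩
      u * t M j + v * t N j ∎
      where s = (- 1#) ^ toℕ j

  private
    sgn : Fin n → Carrier
    sgn j = (- 1#) ^ toℕ j

    minor₂ : Matrix K (suc (suc n)) → Fin (suc n) → Fin (suc n) → Matrix K n
    minor₂ M i j k l = M (suc (punchIn i k)) (suc (punchIn j l))

    -- Two sizes enter the induction: `suc n` to expand a minor along its first column, and `n` to
    -- turn the doubly reduced minors back.
    TransposeInvariant : ℕ → Set _
    TransposeInvariant n = (M : Matrix K n) → det K (λ i j → M j i) ≈ det K M

    -- Expands along the first row, and the minors along their first column;
    -- the result is visibly symmetric under transposition.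
    module _ {n} (ih₁ : TransposeInvariant (suc n)) (ih₀ : TransposeInvariant n)
             (M : Matrix K (suc (suc n))) where
      lead : Carrier
      lead = 1# * M zero zero * det K (minor M zero)

      cross : Fin (suc n) → Fin (suc n) → Carrier
      cross i j = - 1# * sgn j * M zero (suc j) * (sgn i * M (suc i) zero * det K (minor₂ M i j))

      det-cross : det K M ≈ lead + sum λ j → sum λ i → cross i j
      det-cross = +-congˡ (sum-cong-≋ {suc n} λ j → begin
        - 1# * sgn j * M zero (suc j) * det K (minor M (suc j))
          ≈⟨ *-congˡ (ih₁ (minor M (suc j))) ⟨
        - 1# * sgn j * M zero (suc j) * det K (λ k l → minor M (suc j) l k)
          ≈⟨ *-congˡ (sum-cong-≋ {suc n} λ i → *-congˡ {sgn i * M (suc i) zero} (ih₀ (minor₂ M i j))) ⟩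
        - 1# * sgn j * M zero (suc j) * sum (λ i → sgn i * M (suc i) zero * det K (minor₂ M i j))
          ≈⟨ *-distribˡ-sum _ (λ i → sgn i * M (suc i) zero * det K (minor₂ M i j)) ⟩
        sum (λ i → cross i j) ∎)

    transpose-step : ∀ {n} → TransposeInvariant (suc n) → TransposeInvariant n → TransposeInvariant (suc (suc n))
    transpose-step {n} ih₁ ih₀ M = begin
      det K Mᵀ
        ≈⟨ det-cross ih₁ ih₀ Mᵀ ⟩
      lead ih₁ ih₀ Mᵀ + sum (λ j → sum λ i → cross ih₁ ih₀ Mᵀ i j)
        ≈⟨ +-cong (*-congˡ (ih₁ (minor M zero))) (∑-comm {suc n} {suc n} λ j i → cross ih₁ ih₀ Mᵀ i j) ⟩
      lead ih₁ ih₀ M + sum (λ i → sum λ j → cross ih₁ ih₀ Mᵀ i j)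
        ≈⟨ +-congˡ (sum-cong-≋ {suc n} λ i → sum-cong-≋ {suc n} λ j → begin
             - 1# * sgn j * M (suc j) zero * (sgn i * M zero (suc i) * det K (minor₂ Mᵀ i j))
               ≈⟨ solve 5 (λ a b m n d → :- 1ₚ :* a :* m :* (b :* n :* d)
                            := :- 1ₚ :* b :* n :* (a :* m :* d))
                    refl (sgn j) (sgn i) (M (suc j) zero) (M zero (suc i)) _ ⟩
             - 1# * sgn i * M zero (suc i) * (sgn j * M (suc j) zero * det K (minor₂ Mᵀ i j))
               ≈⟨ *-congˡ (*-congˡ (ih₀ (minor₂ M j i))) ⟩
             cross ih₁ ih₀ M j i ∎) ⟩
      lead ih₁ ih₀ M + sum (λ i → sum λ j → cross ih₁ ih₀ M j i)
        ≈⟨ det-cross ih₁ ih₀ M ⟨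
      det K M ∎
      where
      Mᵀ : Matrix K (suc (suc n))
      Mᵀ i j = M j i

  det-transpose : (M : Matrix K n) → det K (λ i j → M j i) ≈ det K M
  det-transpose {zero}        M = refl
  det-transpose {suc zero}    M = refl
  det-transpose {suc (suc n)} M = transpose-step det-transpose det-transpose M

  -- The terms of columns 0 and 1 have equal minors and opposite signs. Every other minor still has
  -- its two equal columns in front and vanishes by induction. Expansion along the first row makes
  -- this direct for columns; rows follow by transposition.
  det-columns₀₁-equal : (M : Matrix K (suc (suc n))) → (∀ i → M i 0F ≈ M i 1F) → det K M ≈ 0#
  det-columns₀₁-equal {n} M eq = begin
    det K M
      ≈⟨ +-congˡ (+-congˡ (sum-zero {n} rest)) ⟩
    1# * M 0F 0F * det K (minor M 0F) + (- 1# * 1# * M 0F 1F * det K (minor M 1F) + 0#)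
      ≈⟨ +-congˡ (+-congʳ (*-cong (*-congˡ (eq 0F)) (det-cong minor₀≈minor₁))) ⟨
    1# * M 0F 0F * det K (minor M 0F) + (- 1# * 1# * M 0F 0F * det K (minor M 0F) + 0#)
      ≈⟨ solve 2 (λ m d → 1ₚ :* m :* d :+ (:- 1ₚ :* 1ₚ :* m :* d :+ 0ₚ) := 0ₚ) refl _ _ ⟩
    0# ∎
    where
    minor₀≈minor₁ : ∀ i l → minor M 0F i l ≈ minor M 1F i l
    minor₀≈minor₁ i zero    = sym (eq (suc i))
    minor₀≈minor₁ i (suc l) = refl

    minor-equal : ∀ {n} (M : Matrix K (suc (suc n))) → (∀ i → M i 0F ≈ M i 1F) →
                  (j : Fin n) → det K (minor M (suc (suc j))) ≈ 0#
    minor-equal {suc n} M eq j = det-columns₀₁-equal (minor M (suc (suc j))) (eq ∘ suc)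

    rest : (j : Fin n) → (- 1#) ^ toℕ (suc (suc j)) * M zero (suc (suc j)) * det K (minor M (suc (suc j))) ≈ 0#
    rest j = trans (*-congˡ (minor-equal M eq j)) (zeroʳ _)

  det-row₀-unit : (M : Matrix K (suc n)) → M zero zero ≈ 1# → (∀ j → M zero (suc j) ≈ 0#) →
                  det K M ≈ det K (λ i j → M (suc i) (suc j))
  det-row₀-unit {n} M head tail = begin
    det K M                              ≈⟨ +-cong (*-congʳ (*-congˡ head)) (sum-zero {n} vanish) ⟩
    1# * 1# * det K (minor M zero) + 0#  ≈⟨ solve 1 (λ d → 1ₚ :* 1ₚ :* d :+ 0ₚ := d) refl _ ⟩
    det K (minor M zero)                 ∎
    where
    vanish : ∀ j → (- 1#) ^ toℕ (suc j) * M zero (suc j) * det K (minor M (suc j)) ≈ 0#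
    vanish j = trans (*-congʳ (trans (*-congˡ (tail j)) (zeroʳ _))) (zeroˡ _)

  private
    infixl 8 _[_]≔_
    _[_]≔_ : Matrix K n → Fin n → Vector Carrier n → Matrix K n
    M [ i ]≔ r = updateAt M i (const r)

    [≔]-at : ∀ (M : Matrix K n) i {r} l → (M [ i ]≔ r) i l ≈ r l
    [≔]-at M i l = reflexive (≡.cong (_$ l) (updateAt-updates i M))

    [≔]-off : ∀ (M : Matrix K n) {i j r} → j ≢ i → ∀ l → (M [ i ]≔ r) j l ≈ M j l
    [≔]-off M {i} {j} j≢i l = reflexive (≡.cong (_$ l) (updateAt-minimal j i M j≢i))

  det-update-linear : ∀ (M : Matrix K n) i u v (r s t : Vector Carrier n) →
                      (∀ l → t l ≈ u * r l + v * s l) →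
                      det K (M [ i ]≔ t) ≈ u * det K (M [ i ]≔ r) + v * det K (M [ i ]≔ s)
  det-update-linear M i u v r s t t≈ = det-linear i u v
    (λ l → trans ([≔]-at M i l) (trans (t≈ l)
             (+-cong (*-congˡ (sym ([≔]-at M i l))) (*-congˡ (sym ([≔]-at M i l))))))
    (λ j j≢i l → trans ([≔]-off M j≢i l) (sym ([≔]-off M j≢i l)))
    (λ j j≢i l → trans ([≔]-off M j≢i l) (sym ([≔]-off M j≢i l)))

  private
    module _ (M : Matrix K n) {i j : Fin n} (i≢j : i ≢ j) where
      det₂ : Vector Carrier n → Vector Carrier n → Carrier
      det₂ r s = det K (M [ i ]≔ r [ j ]≔ s)

      det₂-linearʳ : ∀ r {s t t′} → (∀ l → t′ l ≈ s l + t l) → det₂ r t′ ≈ det₂ r s + det₂ r t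
      det₂-linearʳ r {s} {t} {t′} t′≈ = trans
        (det-update-linear (M [ i ]≔ r) j 1# 1# s t t′
          (λ l → trans (t′≈ l) (sym (+-cong (*-identityˡ _) (*-identityˡ _)))))
        (+-cong (*-identityˡ _) (*-identityˡ _))

      -- `det-update-linear` sees only the outermost update, so the updates of the distinct rows `i`
      -- and `j` are first interchanged.
      det₂-linearˡ : ∀ {r r′ r″} s → (∀ l → r″ l ≈ r l + r′ l) → det₂ r″ s ≈ det₂ r s + det₂ r′ s
      det₂-linearˡ {r} {r′} {r″} s r″≈ = begin
        det₂ r″ s                  ≈⟨ det-cong (commute r″) ⟩
        det K (M [ j ]≔ s [ i ]≔ r″)
          ≈⟨ det-update-linear (M [ j ]≔ s) i 1# 1# r r′ r″
               (λ l → trans (r″≈ l) (sym (+-cong (*-identityˡ _) (*-identityˡ _)))) ⟩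
        1# * det K (M [ j ]≔ s [ i ]≔ r) + 1# * det K (M [ j ]≔ s [ i ]≔ r′)
          ≈⟨ +-cong (*-identityˡ _) (*-identityˡ _) ⟩
        det K (M [ j ]≔ s [ i ]≔ r) + det K (M [ j ]≔ s [ i ]≔ r′)
          ≈⟨ +-cong (det-cong (commute r)) (det-cong (commute r′)) ⟨
        det₂ r s + det₂ r′ s ∎
        where
        commute : ∀ r k l → (M [ i ]≔ r [ j ]≔ s) k l ≈ (M [ j ]≔ s [ i ]≔ r) k l
        commute r k l = reflexive (≡.cong (_$ l) (≡.sym (updateAt-commutes i j i≢j M k)))

      -- Polarisation of det₂ (r + s) (r + s) ≈ 0.
      det₂-antisym : (∀ r → det₂ r r ≈ 0#) → ∀ r s → det₂ r s ≈ - det₂ s r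
      det₂-antisym alt r s = +-inverseˡ-unique _ _ (begin
        det₂ r s + det₂ s r
          ≈⟨ +-cong (+-identityˡ _) (+-identityʳ _) ⟨
        (0# + det₂ r s) + (det₂ s r + 0#)
          ≈⟨ +-cong (+-congʳ (alt r)) (+-congˡ (alt s)) ⟨
        (det₂ r r + det₂ r s) + (det₂ s r + det₂ s s)
          ≈⟨ +-cong (det₂-linearʳ r (λ _ → refl)) (det₂-linearʳ s (λ _ → refl)) ⟨
        det₂ r r+s + det₂ s r+s
          ≈⟨ det₂-linearˡ r+s (λ _ → refl) ⟨
        det₂ r+s r+s
          ≈⟨ alt r+s ⟩
        0# ∎)
        where
        r+s : Vector Carrier n
        r+s l = r l + s l

    det-rows₀₁-equal : (M : Matrix K (suc (suc n))) → (∀ j → M 0F j ≈ M 1F j) → det K M ≈ 0#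
    det-rows₀₁-equal M eq = trans (sym (det-transpose M)) (det-columns₀₁-equal (λ i j → M j i) eq)

  -- So far only equal rows 0 and 1 are known to give zero. Polarising this one case yields the swap
  -- with which `row₀-equal` moves row 0 out of the first position.
  det-rows₀₁-swap : (M : Matrix K (suc (suc n))) →
                    det K M ≈ - det K (M 1F Vector.∷ M 0F Vector.∷ λ i → M (suc (suc i)))
  det-rows₀₁-swap {n} M = begin
    det K M                    ≈⟨ det-cong {M = M} {M [ 0F ]≔ M 0F [ 1F ]≔ M 1F} same ⟩
    det₂ M 0≢1 (M 0F) (M 1F)   ≈⟨ det₂-antisym M 0≢1 alt (M 0F) (M 1F) ⟩
    - det₂ M 0≢1 (M 1F) (M 0F) ≈⟨ -‿cong (det-cong {M = M [ 0F ]≔ M 1F [ 1F ]≔ M 0F} {M′} swapped) ⟩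
    - det K M′                 ∎
    where
    M′ : Matrix K (suc (suc n))
    M′ = M 1F Vector.∷ M 0F Vector.∷ λ i → M (suc (suc i))

    0≢1 : 0F ≢ 1F
    0≢1 ()

    alt : ∀ r → det₂ M 0≢1 r r ≈ 0#
    alt r = det-rows₀₁-equal (M [ 0F ]≔ r [ 1F ]≔ r) (λ _ → refl)

    same : ∀ i l → M i l ≈ (M [ 0F ]≔ M 0F [ 1F ]≔ M 1F) i l
    same 0F            l = refl
    same 1F            l = refl
    same (suc (suc i)) l = refl

    swapped : ∀ i l → (M [ 0F ]≔ M 1F [ 1F ]≔ M 0F) i l ≈ M′ i l
    swapped 0F            l = refl
    swapped 1F            l = refl
    swapped (suc (suc i)) l = refl

  private
    RowAlternating : ℕ → Set _
    RowAlternating n = (M : Matrix K n) {i j : Fin n} → i ≢ j → (∀ l → M i l ≈ M j l) → det K M ≈ 0#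

    minors-zero : (M : Matrix K (suc n)) → (∀ j → det K (minor M j) ≈ 0#) → det K M ≈ 0#
    minors-zero {n} M zeros = sum-zero {suc n} λ j → trans
      (*-congˡ (zeros j)) (zeroʳ ((- 1#) ^ toℕ j * M zero j))

    -- Every first-row minor loses row 0, so that row is first swapped with row 1. Then both equal
    -- rows survive in all minors, where `alt` applies at the smaller size.
    row₀-equal : RowAlternating n → (M : Matrix K (suc n)) (j : Fin n) →
                 (∀ l → M zero l ≈ M (suc j) l) → det K M ≈ 0#
    row₀-equal alt M zero eq = det-rows₀₁-equal M eq
    row₀-equal {suc n} alt M (suc j) eq = begin
      det K M    ≈⟨ det-rows₀₁-swap M ⟩
      - det K M′ ≈⟨ -‿cong (minors-zero M′ λ l → alt (minor M′ l) {0F} {suc j} (λ ()) (eq ∘ punchIn l)) ⟩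
      - 0#       ≈⟨ -0#≈0# ⟩
      0#         ∎
      where
      M′ : Matrix K (suc (suc n))
      M′ = M 1F Vector.∷ M 0F Vector.∷ λ i → M (suc (suc i))

  det-rows-equal : (M : Matrix K n) {i j : Fin n} → i ≢ j → (∀ l → M i l ≈ M j l) → det K M ≈ 0#
  det-rows-equal M {zero}  {zero}  i≢j eq = contradiction ≡.refl i≢j
  det-rows-equal M {zero}  {suc j} i≢j eq = row₀-equal det-rows-equal M j eq
  det-rows-equal M {suc i} {zero}  i≢j eq = row₀-equal det-rows-equal M i (sym ∘ eq)
  det-rows-equal M {suc i} {suc j} i≢j eq = minors-zero M λ m →
    det-rows-equal (minor M m) (i≢j ∘ ≡.cong suc) (eq ∘ punchIn m)

  det-rows-swap : ∀ (M : Matrix K n) {i j} → i ≢ j →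
                  det K (λ k → M (transpose i j k)) ≈ - det K M
  det-rows-swap {n} M {i} {j} i≢j = begin
    det K (λ k → M (transpose i j k)) ≈⟨ det-cong swapped ⟩
    det₂ M i≢j (M j) (M i)             ≈⟨ det₂-antisym M i≢j alt (M j) (M i) ⟩
    - det₂ M i≢j (M i) (M j)           ≈⟨ -‿cong (det-cong restored) ⟩
    - det K M                          ∎
    where
    at-i : ∀ r s l → (M [ i ]≔ r [ j ]≔ s) i l ≈ r l
    at-i r s l = trans ([≔]-off (M [ i ]≔ r) i≢j l) ([≔]-at M i l)

    off : ∀ r s {k} → k ≢ i → k ≢ j → ∀ l → (M [ i ]≔ r [ j ]≔ s) k l ≈ M k l
    off r s k≢i k≢j l = trans ([≔]-off (M [ i ]≔ r) k≢j l) ([≔]-off M k≢i l)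

    alt : ∀ r → det₂ M i≢j r r ≈ 0#
    alt r = det-rows-equal (M [ i ]≔ r [ j ]≔ r) i≢j λ l →
      trans (at-i r r l) (sym ([≔]-at (M [ i ]≔ r) j l))

    swapped : ∀ k l → M (transpose i j k) l ≈ (M [ i ]≔ M j [ j ]≔ M i) k l
    swapped k l with k Fin.≟ i
    ... | yes ≡.refl = sym (at-i (M j) (M i) l)
    ... | no k≢i with k Fin.≟ j
    ...   | yes ≡.refl = sym ([≔]-at (M [ i ]≔ M j) j l)
    ...   | no k≢j     = sym (off (M j) (M i) k≢i k≢j l)

    restored : ∀ k l → (M [ i ]≔ M i [ j ]≔ M j) k l ≈ M k l
    restored k l with k Fin.≟ i
    ... | yes ≡.refl = at-i (M i) (M j) l
    ... | no k≢i with k Fin.≟ j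
    ...   | yes ≡.refl = [≔]-at (M [ i ]≔ M i) j l
    ...   | no k≢j     = off (M i) (M j) k≢i k≢j l

  -- One sign comes from the rows and one from the columns, the latter read as rows of the
  -- transposed matrix. The swap lemma needs distinct rows, hence the separate case of a trivial
  -- transposition.
  det-transposition : ∀ (M : Matrix K n) i j →
                      det K (λ k l → M (transpose i j k) (transpose i j l)) ≈ det K M
  det-transposition M i j with i Fin.≟ j
  ... | yes ≡.refl = det-cong λ k l → reflexive (≡.cong₂ M (fixed k) (fixed l))
    where
    fixed : ∀ k → transpose i i k ≡ k
    -- Both tests inside `transpose i i` compare `k` with `i`, hence the repeated `with`.
    fixed k with k Fin.≟ i
    ... | yes k≡i = ≡.sym k≡i
    ... | no k≢i with k Fin.≟ i
    ...   | yes k≡i = ≡.sym k≡i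
    ...   | no _    = ≡.refl
  ... | no i≢j = begin
    det K (λ k l → M (τ k) (τ l)) ≈⟨ det-rows-swap (λ k l → M k (τ l)) i≢j ⟩
    - det K (λ k l → M k (τ l))   ≈⟨ -‿cong (det-transpose (λ k l → M k (τ l))) ⟨
    - det K (λ l k → M k (τ l))   ≈⟨ -‿cong (det-rows-swap (λ l k → M k l) i≢j) ⟩
    - - det K (λ l k → M k l)     ≈⟨ -‿involutive _ ⟩
    det K (λ l k → M k l)         ≈⟨ det-transpose M ⟩
    det K M                       ∎
    where τ = transpose i j

  -- The lists to be compared have lengths that are not definitionally equal, so `π` joins two index
  -- types. Its existence identifies them, and a decomposition into transpositions does the rest.
  det-permute : (π : Permutation m n) {M : Matrix K m} {N : Matrix K n} →
                (∀ i j → M i j ≈ N (π ⟨$⟩ʳ i) (π ⟨$⟩ʳ j)) → det K M ≈ det K N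
  det-permute π M≈N with ↔⇒≡ π
  det-permute {n} π {M} {N} M≈N | ≡.refl = begin
    det K M                                              ≈⟨ det-cong M≈N ⟩
    det K (λ i j → N (π ⟨$⟩ʳ i) (π ⟨$⟩ʳ j))              ≈⟨ det-cong (λ i j → reflexive
                                                              (≡.cong₂ N (eval-decompose π i) (eval-decompose π j))) ⟨
    det K (λ i j → N (eval ts ⟨$⟩ʳ i) (eval ts ⟨$⟩ʳ j))  ≈⟨ transpositions ts ⟩
    det K N                                              ∎
    where
    ts : TranspositionList n
    ts = decompose π

    transpositions : ∀ ts → det K (λ i j → N (eval ts ⟨$⟩ʳ i) (eval ts ⟨$⟩ʳ j)) ≈ det K N
    transpositions []             = refl
    transpositions ((i , j) ∷ ts) = trans
      (det-transposition (λ i j → N (eval ts ⟨$⟩ʳ i) (eval ts ⟨$⟩ʳ j)) i j)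
      (transpositions ts)

-- Characteristic determinants of weighted lists of classes, and the merging of twins

lookup-map : {A : Set a} {B : Set b} (f : A → B) (xs : List A) (i : Fin (length xs)) →
             lookup (map f xs) (cast (≡.sym (List.length-map f xs)) i) ≡ f (lookup xs i)
lookup-map f (x ∷ xs) zero    = ≡.refl
lookup-map f (x ∷ xs) (suc i) = lookup-map f xs i

module WeightedCharPoly (K : CommutativeRing k ℓ) {C : Set c}
                        (adj : C → C → CommutativeRing.Carrier K) (x : CommutativeRing.Carrier K) where
  open CommutativeRing K hiding (zero)
  open RawSemiringDefs (Semiring.rawSemiring semiring) using (_^_) renaming (_×_ to _×ℕ_)
  open Exp semiring using (^-homo-*)
  open RingProperties ring
  open Determinant K
  open IntegerSolver K
  open SetoidReasoning setoid

  private
    variable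
      m n : ℕ

  module _ (cls : Vector C n) (w : Vector Carrier n) where
    weightedMatrix : Matrix K n
    weightedMatrix i j = x * identity K i j - w i * adj (cls i) (cls j)

    weightedDet : Carrier
    weightedDet = det K weightedMatrix

  weightedDet-cong : {cls cls′ : Vector C n} {w w′ : Vector Carrier n} →
                     (∀ i → cls i ≡ cls′ i) → (∀ i → w i ≈ w′ i) →
                     weightedDet cls w ≈ weightedDet cls′ w′
  weightedDet-cong cls≗ w≈ = det-cong λ i j →
    +-congˡ (-‿cong (*-cong (w≈ i) (reflexive (≡.cong₂ adj (cls≗ i) (cls≗ j)))))

  -- The diagonal of x I is carried to the diagonal because `π` is injective.
  weightedDet-permute : (π : Permutation m n) {cls : Vector C m} {cls′ : Vector C n}
                        {w : Vector Carrier m} {w′ : Vector Carrier n} →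
                        (∀ i → cls i ≡ cls′ (π ⟨$⟩ʳ i)) → (∀ i → w i ≈ w′ (π ⟨$⟩ʳ i)) →
                        weightedDet cls w ≈ weightedDet cls′ w′
  weightedDet-permute π cls≗ w≈ = det-permute π λ i j → +-cong
    (*-congˡ (reflexive (≡.cong (if_then 1# else 0#) (does-⇔
      (mk⇔ (≡.cong (π ⟨$⟩ʳ_))
           (λ eq → ≡.trans (≡.sym (inverseˡ π)) (≡.trans (≡.cong (π ⟨$⟩ˡ_) eq) (inverseˡ π))))
      (i Fin.≟ j) (π ⟨$⟩ʳ i Fin.≟ π ⟨$⟩ʳ j)))))
    (-‿cong (*-cong (w≈ i) (reflexive (≡.cong₂ adj (cls≗ i) (cls≗ j)))))

  -- Lists rather than vectors: reordering becomes `_↭_` and grouping into blocks becomes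
  -- `concatMap`.
  listDet : List (C × Carrier) → Carrier
  listDet l = weightedDet (proj₁ ∘ lookup l) (proj₂ ∘ lookup l)

  listDet-map : {A : Set a} (h : A → C × Carrier) (xs : List A) →
                listDet (map h xs) ≈ weightedDet (proj₁ ∘ h ∘ lookup xs) (proj₂ ∘ h ∘ lookup xs)
  listDet-map h xs = sym (weightedDet-permute (cast-id (≡.sym (List.length-map h xs)))
    (λ i → ≡.sym (≡.cong proj₁ (lookup-map h xs i)))
    (λ i → reflexive (≡.sym (≡.cong proj₂ (lookup-map h xs i)))))

  listDet-↭ : ∀ {l l′} → l ↭ l′ → listDet l ≈ listDet l′
  listDet-↭ {l} {l′} l↭l′ = weightedDet-permute (onIndices p)
    (λ i → ≡.cong proj₁ (onIndices-lookup S p i))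
    (λ i → reflexive (≡.cong proj₂ (onIndices-lookup S p i)))
    where
    S = ≡.setoid (C × Carrier)
    p = ↭⇒↭ₛ l↭l′

  listDet-head : ∀ k {v w} l → v ≈ w → listDet ((k , v) ∷ l) ≈ listDet ((k , w) ∷ l)
  listDet-head k {v} {w} l v≈w = weightedDet-cong
    {cls = proj₁ ∘ lookup l₁} {proj₁ ∘ lookup l₂} {proj₂ ∘ lookup l₁} {proj₂ ∘ lookup l₂}
    (λ { zero → ≡.refl ; (suc i) → ≡.refl }) (λ { zero → v≈w ; (suc i) → refl })
    where
    l₁ = (k , v) ∷ l
    l₂ = (k , w) ∷ l

  -- With e₀, e₁ the first two rows of the identity and u the adjacency row of
  -- the class k, bilinearity in the first two rows reduces the claim to
  -- T u e₁ ≈ T e₀ u, i.e. T u (e₀ + e₁) ≈ 0, where the first two columns agree.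
  listDet-merge : ∀ k v w l → listDet ((k , v) ∷ (k , w) ∷ l) ≈ x * listDet ((k , v + w) ∷ l)
  listDet-merge k v w l = begin
    listDet ((k , v) ∷ (k , w) ∷ l)
      ≈⟨ det-cong {M = W} {row e₀ v Vector.∷ row e₁ w Vector.∷ rest} split ⟩
    T (row e₀ v) (row e₁ w)
      ≈⟨ T-linearˡ {e₀} {u} {row e₀ v} {row e₁ w} x (- v) (λ j → +-congˡ (-‿distribˡ-* v (u j))) ⟩
    x * T e₀ (row e₁ w) + - v * T u (row e₁ w)
      ≈⟨ +-congˡ (*-congˡ (T-linearʳ {e₁} {u} {row e₁ w} {u} x (- w) (λ j → +-congˡ (-‿distribˡ-* w (u j))))) ⟩
    x * T e₀ (row e₁ w) + - v * (x * T u e₁ + - w * T u u)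
      ≈⟨ +-congˡ (*-congˡ (+-cong (*-congˡ Tue₁≈Te₀u) (*-congˡ Tuu≈0))) ⟩
    x * T e₀ (row e₁ w) + - v * (x * T e₀ u + - w * 0#)
      ≈⟨ solve 5 (λ x v w a b → x :* a :+ :- v :* (x :* b :+ :- w :* 0ₚ) := x :* (1ₚ :* a :+ :- v :* b))
           refl x v w (T e₀ (row e₁ w)) (T e₀ u) ⟩
    x * (1# * T e₀ (row e₁ w) + - v * T e₀ u)
      ≈⟨ *-congˡ (T-linearʳ {row e₁ w} {u} {row e₁ (v + w)} {e₀} 1# (- v) (λ j →
           solve 5 (λ x e v w u → x :* e :- (v :+ w) :* u := 1ₚ :* (x :* e :- w :* u) :+ :- v :* u)
             refl x (e₁ j) v w (u j))) ⟨
    x * T e₀ (row e₁ (v + w))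
      ≈⟨ *-congˡ expand ⟩
    x * listDet ((k , v + w) ∷ l) ∎
    where
    N = suc (suc (length l))

    cls : Vector C N
    cls = proj₁ ∘ lookup ((k , v) ∷ (k , w) ∷ l)

    W : Matrix K N
    W = weightedMatrix cls (proj₂ ∘ lookup ((k , v) ∷ (k , w) ∷ l))

    e₀ e₁ u : Vector Carrier N
    e₀  = identity K zero
    e₁  = identity K (suc zero)
    u j = adj k (cls j)

    row : Vector Carrier N → Carrier → Vector Carrier N
    row e v j = x * e j - v * u j

    rest : Vector (Vector Carrier N) (length l)
    rest i = W (suc (suc i))

    T : Vector Carrier N → Vector Carrier N → Carrier
    T r s = det K (r Vector.∷ s Vector.∷ rest)

    split : ∀ i j → W i j ≈ (row e₀ v Vector.∷ row e₁ w Vector.∷ rest) i j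
    split zero          j = refl
    split (suc zero)    j = refl
    split (suc (suc i)) j = refl

    T-linearˡ : ∀ {r s t t′} a b → (∀ j → t j ≈ a * r j + b * s j) → T t t′ ≈ a * T r t′ + b * T s t′
    T-linearˡ {r} {s} {t} {t′} a b t≈ = det-linear {N} zero
      {t Vector.∷ t′ Vector.∷ rest} {r Vector.∷ t′ Vector.∷ rest} {s Vector.∷ t′ Vector.∷ rest} a b t≈
      (λ { zero i≢i → contradiction ≡.refl i≢i ; (suc i) _ j → refl })
      (λ { zero i≢i → contradiction ≡.refl i≢i ; (suc i) _ j → refl })

    T-linearʳ : ∀ {r s t t′} a b → (∀ j → t j ≈ a * r j + b * s j) → T t′ t ≈ a * T t′ r + b * T t′ s
    T-linearʳ {r} {s} {t} {t′} a b t≈ = det-linear {N} (suc zero)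
      {t′ Vector.∷ t Vector.∷ rest} {t′ Vector.∷ r Vector.∷ rest} {t′ Vector.∷ s Vector.∷ rest} a b t≈
      (λ { zero _ j → refl ; (suc zero) i≢i → contradiction ≡.refl i≢i ; (suc (suc i)) _ j → refl })
      (λ { zero _ j → refl ; (suc zero) i≢i → contradiction ≡.refl i≢i ; (suc (suc i)) _ j → refl })

    Tuu≈0 : T u u ≈ 0#
    Tuu≈0 = det-rows-equal (u Vector.∷ u Vector.∷ rest) {zero} {suc zero} (λ ()) (λ _ → refl)

    e₀+e₁ : Vector Carrier N
    e₀+e₁ j = 1# * e₀ j + 1# * e₁ j

    columns-equal : ∀ i → (u Vector.∷ e₀+e₁ Vector.∷ rest) i 0F ≈ (u Vector.∷ e₀+e₁ Vector.∷ rest) i 1F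
    columns-equal zero          = refl
    columns-equal (suc zero)    = +-comm (1# * 1#) (1# * 0#)
    columns-equal (suc (suc i)) = refl

    Tue₁≈Te₀u : T u e₁ ≈ T e₀ u
    Tue₁≈Te₀u = begin
      T u e₁                        ≈⟨ solve 2 (λ a b → a := 1ₚ :* b :+ 1ₚ :* a :- b) refl (T u e₁) (T u e₀) ⟩
      1# * T u e₀ + 1# * T u e₁ - T u e₀
        ≈⟨ +-congʳ (T-linearʳ {e₀} {e₁} {e₀+e₁} {u} 1# 1# (λ _ → refl)) ⟨
      T u e₀+e₁ - T u e₀            ≈⟨ +-congʳ (det-columns₀₁-equal (u Vector.∷ e₀+e₁ Vector.∷ rest) columns-equal) ⟩
      0# - T u e₀                   ≈⟨ +-identityˡ _ ⟩
      - T u e₀                      ≈⟨ det-rows₀₁-swap (e₀ Vector.∷ u Vector.∷ rest) ⟨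
      T e₀ u                        ∎

    -- Row `e₀` is a unit row, so the expansion deletes row and column 0, which belong to the first
    -- twin; the second remains, with the total weight.
    expand : T e₀ (row e₁ (v + w)) ≈ listDet ((k , v + w) ∷ l)
    expand = trans (det-row₀-unit (e₀ Vector.∷ row e₁ (v + w) Vector.∷ rest) refl (λ _ → refl))
      (det-cong {M = λ i j → (row e₁ (v + w) Vector.∷ rest) i (suc j)} {W′} same)
      where
      l′ = (k , v + w) ∷ l
      W′ = weightedMatrix (proj₁ ∘ lookup l′) (proj₂ ∘ lookup l′)
      same : ∀ i j → (row e₁ (v + w) Vector.∷ rest) i (suc j) ≈ W′ i j
      same zero    zero    = refl
      same zero    (suc j) = refl
      same (suc i) zero    = refl
      same (suc i) (suc j) = refl

  -- Stated for every weight `v`, since each absorbed twin raises the weight of the head before the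
  -- induction hypothesis is applied.
  listDet-absorb : ∀ n k v l → listDet ((k , v) ∷ replicate n (k , 1#) ++ l)
                             ≈ x ^ n * listDet ((k , v + n ×ℕ 1#) ∷ l)
  listDet-absorb zero    k v l = trans (listDet-head k l (sym (+-identityʳ v))) (sym (*-identityˡ _))
  listDet-absorb (suc n) k v l = begin
    listDet ((k , v) ∷ (k , 1#) ∷ replicate n (k , 1#) ++ l)
      ≈⟨ listDet-merge k v 1# (replicate n (k , 1#) ++ l) ⟩
    x * listDet ((k , v + 1#) ∷ replicate n (k , 1#) ++ l)
      ≈⟨ *-congˡ (listDet-absorb n k (v + 1#) l) ⟩
    x * (x ^ n * listDet ((k , v + 1# + n ×ℕ 1#) ∷ l))
      ≈⟨ *-assoc x _ _ ⟨
    x ^ suc n * listDet ((k , v + 1# + n ×ℕ 1#) ∷ l)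
      ≈⟨ *-congˡ (listDet-head k l (+-assoc v 1# _)) ⟩
    x ^ suc n * listDet ((k , v + suc n ×ℕ 1#) ∷ l) ∎

  -- A block (k , n) stands for suc n elements of the class k.
  blocks weights : List (C × ℕ) → List (C × Carrier)
  blocks  = concatMap λ (k , n) → replicate (suc n) (k , 1#)
  weights = map λ (k , n) → k , suc n ×ℕ 1#

  -- Here `l` collects the vertices merged so far. A finished vertex is rotated to the end of the
  -- list, which brings the next block to the front, where merging takes place, and keeps the order
  -- of `weights bs`.
  listDet-blocks-++ : ∀ bs l → listDet (blocks bs ++ l)
                           ≈ x ^ sumℕ (map proj₂ bs) * listDet (l ++ weights bs)
  listDet-blocks-++ []             l = trans
    (reflexive (≡.cong listDet (≡.sym (List.++-identityʳ l)))) (sym (*-identityˡ _))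
  listDet-blocks-++ ((k , n) ∷ bs) l = begin
    listDet ((k , 1#) ∷ (replicate n (k , 1#) ++ blocks bs) ++ l)
      ≡⟨ ≡.cong (λ r → listDet ((k , 1#) ∷ r)) (List.++-assoc (replicate n (k , 1#)) (blocks bs) l) ⟩
    listDet ((k , 1#) ∷ replicate n (k , 1#) ++ (blocks bs ++ l))
      ≈⟨ listDet-absorb n k 1# (blocks bs ++ l) ⟩
    x ^ n * listDet (kn ∷ blocks bs ++ l)
      ≈⟨ *-congˡ (listDet-↭ (↭.trans (∷↭∷ʳ kn (blocks bs ++ l))
           (↭.↭-reflexive (List.++-assoc (blocks bs) l (kn ∷ []))))) ⟩
    x ^ n * listDet (blocks bs ++ (l ++ kn ∷ []))
      ≈⟨ *-congˡ (listDet-blocks-++ bs (l ++ kn ∷ [])) ⟩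
    x ^ n * (x ^ sumℕ (map proj₂ bs) * listDet ((l ++ kn ∷ []) ++ weights bs))
      ≈⟨ *-assoc (x ^ n) _ _ ⟨
    x ^ n * x ^ sumℕ (map proj₂ bs) * listDet ((l ++ kn ∷ []) ++ weights bs)
      ≈⟨ *-cong (^-homo-* x n _) (reflexive (≡.cong listDet (≡.sym (List.++-assoc l (kn ∷ []) (weights bs))))) ⟨
    x ^ (n ℕ.+ sumℕ (map proj₂ bs)) * listDet (l ++ kn ∷ weights bs) ∎
    where kn = k , suc n ×ℕ 1#

  listDet-blocks : ∀ bs → listDet (blocks bs) ≈ x ^ sumℕ (map proj₂ bs) * listDet (weights bs)
  listDet-blocks bs = trans
    (reflexive (≡.cong listDet (≡.sym (List.++-identityʳ (blocks bs)))))
    (listDet-blocks-++ bs [])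

-- Supports in the cube and the determinant of the six-vertex quotient

Support : Set
Support = Bool × Bool × Bool

disjoint : Support → Support → Bool
disjoint (a , b , c) (a′ , b′ , c′) = not (a ∧ a′) ∧ not (b ∧ b′) ∧ not (c ∧ c′)

-- The singletons come first, and the support at index i + 3 is the complement of the one at index
-- i.
properSupport : Fin 6 → Support
properSupport 0F = true , false , false
properSupport 1F = false , true , false
properSupport 2F = false , false , true
properSupport 3F = false , true , true
properSupport 4F = true , false , true
properSupport 5F = true , true , false

-- Polymorphic because the same pattern serves for elements of `K`, solver polynomials, block
-- lengths and multiplicities.
properWeight : {A : Set a} → A → A → Fin 6 → A
properWeight q r 0F = q
properWeight q r 1F = q
properWeight q r 2F = q
properWeight q r 3F = r
properWeight q r 4F = r
properWeight q r 5F = r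

module _ (K : CommutativeRing k ℓ) where
  open CommutativeRing K hiding (zero)
  open IntegerSolver K

  disjointness : Support → Support → Carrier
  disjointness s t = if disjoint s t then 1# else 0#

  private
    -- Mirrors det clause by clause, so that its semantics unfolds to det.
    :det : ∀ {m n} → (Fin n → Fin n → Polynomial m) → Polynomial m
    :det {n = zero}  M = 1ₚ
    :det {n = suc n} M = Vector.foldr _:+_ 0ₚ λ j →
      sgn (toℕ j) :* M zero j :* :det λ i l → M (suc i) (punchIn j l)
      where
      sgn : ℕ → Polynomial _
      sgn zero    = 1ₚ
      sgn (suc j) = :- 1ₚ :* sgn j

    :matrix : ∀ {m} → Polynomial m → Polynomial m → Polynomial m → Fin 6 → Fin 6 → Polynomial m
    :matrix x q r i j = x :* (if does (i Fin.≟ j) then 1ₚ else 0ₚ)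
      :- properWeight q r i :* (if disjoint (properSupport i) (properSupport j) then 1ₚ else 0ₚ)

  open WeightedCharPoly K disjointness

  -- Permuting the three coordinates permutes the six classes. Index a pair by its missing
  -- coordinate, and write a vector as (a, b), with a on singletons and b on pairs. If a and b are
  -- constant, W A maps (a, b) to (q(2a + b), ra), which gives the first quadratic. If a and b have
  -- sum zero, it maps (a, b) to (q(b - a), ra), which gives the second, squared because sum-zero
  -- vectors on three coordinates form a plane. The variable `r` becomes q² only later.
  sextic : Carrier → Carrier → Carrier → Carrier
  sextic x q r =
    (x * x - (q + q) * x - q * r) * ((x * x + q * x - q * r) * (x * x + q * x - q * r))

  properDet : ∀ x q r → weightedDet x properSupport (properWeight q r) ≈ sextic x q r
  properDet x q r = prove (x Vec.∷ q Vec.∷ r Vec.∷ Vec.[])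
      (:det (:matrix X Q R))
      ((X :* X :- (Q :+ Q) :* X :- Q :* R) :*
        ((X :* X :+ Q :* X :- Q :* R) :* (X :* X :+ Q :* X :- Q :* R)))
      refl
    where
    X Q R : Polynomial 3
    X = var 0F
    Q = var 1F
    R = var 2F

empty : Support
empty = false , false , false

_∩_ : Support → Support → Support
(a , b , c) ∩ (a′ , b′ , c′) = (a ∧ a′) , (b ∧ b′) , (c ∧ c′)

disjoint⇔∩-empty : ∀ s t → disjoint s t ≡ true ⇔ s ∩ t ≡ empty
disjoint⇔∩-empty (a , b , c) (a′ , b′ , c′) = lemma (a ∧ a′) (b ∧ b′) (c ∧ c′)
  where
  lemma : ∀ u v w → not u ∧ not v ∧ not w ≡ true ⇔ (u , v , w) ≡ empty
  lemma false false false = mk⇔ (λ _ → ≡.refl) (λ _ → ≡.refl)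
  lemma false false true  = mk⇔ (λ ()) (λ ())
  lemma false true  w     = mk⇔ (λ ()) (λ ())
  lemma true  v     w     = mk⇔ (λ ()) (λ ())

data Proper : Support → Set where
  proper : ∀ i → Proper (properSupport i)

disjoint⇒proper : ∀ s t → s ∩ t ≡ empty → s ≢ empty → t ≢ empty → Proper s
disjoint⇒proper (true  , false , false) t _  s≢∅ t≢∅ = proper 0F
disjoint⇒proper (false , true  , false) t _  s≢∅ t≢∅ = proper 1F
disjoint⇒proper (false , false , true)  t _  s≢∅ t≢∅ = proper 2F
disjoint⇒proper (false , true  , true)  t _  s≢∅ t≢∅ = proper 3F
disjoint⇒proper (true  , false , true)  t _  s≢∅ t≢∅ = proper 4F
disjoint⇒proper (true  , true  , false) t _  s≢∅ t≢∅ = proper 5F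
disjoint⇒proper (false , false , false) t _  s≢∅ t≢∅ = contradiction ≡.refl s≢∅
-- Intersecting with the full support leaves `t` unchanged by computation, so `eq` itself says that
-- `t` is empty.
disjoint⇒proper (true  , true  , true)  t eq s≢∅ t≢∅ = contradiction eq t≢∅

-- The witness is the complementary support; an element with that support is the nonzero annihilator
-- that makes a zero-divisor.
proper⇒disjoint : ∀ {s} → Proper s → s ≢ empty × ∃[ t ] t ≢ empty × s ∩ t ≡ empty
proper⇒disjoint (proper 0F) = (λ ()) , properSupport 3F , (λ ()) , ≡.refl
proper⇒disjoint (proper 1F) = (λ ()) , properSupport 4F , (λ ()) , ≡.refl
proper⇒disjoint (proper 2F) = (λ ()) , properSupport 5F , (λ ()) , ≡.refl
proper⇒disjoint (proper 3F) = (λ ()) , properSupport 0F , (λ ()) , ≡.refl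
proper⇒disjoint (proper 4F) = (λ ()) , properSupport 1F , (λ ()) , ≡.refl
proper⇒disjoint (proper 5F) = (λ ()) , properSupport 2F , (λ ()) , ≡.refl

properSupport-injective : ∀ i j → properSupport i ≡ properSupport j → i ≡ j
properSupport-injective i j eq =
  ≡.trans (≡.sym (index-properSupport i)) (≡.trans (≡.cong index eq) (index-properSupport j))
  where
  -- The values at the empty and the full support are irrelevant.
  index : Support → Fin 6
  index (true  , false , false) = 0F
  index (false , true  , false) = 1F
  index (false , false , true)  = 2F
  index (false , true  , true)  = 3F
  index (true  , false , true)  = 4F
  index (true  , true  , false) = 5F
  index _                       = 0F

  index-properSupport : ∀ i → index (properSupport i) ≡ i
  index-properSupport 0F = ≡.refl
  index-properSupport 1F = ≡.refl
  index-properSupport 2F = ≡.refl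
  index-properSupport 3F = ≡.refl
  index-properSupport 4F = ≡.refl
  index-properSupport 5F = ≡.refl

-- Canonical codes for triples of residues modulo `p`

length-cartesianProduct : {A : Set a} {B : Set b} (xs : List A) (ys : List B) →
                          length (cartesianProduct xs ys) ≡ length xs ℕ.* length ys
length-cartesianProduct []       ys = ≡.refl
length-cartesianProduct (x ∷ xs) ys = ≡.trans (List.length-++ (map (x ,_) ys))
  (≡.cong₂ ℕ._+_ (List.length-map (x ,_) ys) (length-cartesianProduct xs ys))

isNonzero : ∀ {n} → Fin n → Bool
isNonzero zero    = false
isNonzero (suc _) = true

module Residues (q : ℕ) where
  p : ℕ
  p = suc q

  Residue : Set
  Residue = Fin p

  -- An element of `ℤ/ p` has infinitely many representatives. A canonical one in `Fin p` makes
  -- propositional equality available, and with it unique lists and their permutations.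
  residue : ℤ → Residue
  residue z = fromℕ< (n%ℕd<d z p)

  private
    difference : ∀ y z → y ℤ.- z ≡ (+ (y %ℕ p) ℤ.- + (z %ℕ p)) ℤ.+ (y /ℕ p ℤ.- z /ℕ p) ℤ.* + p
    difference y z = ≡.trans
      (≡.cong₂ ℤ._-_ (a≡a%ℕn+[a/ℕn]*n y p) (a≡a%ℕn+[a/ℕn]*n z p))
      (lemma (+ (y %ℕ p)) (+ (z %ℕ p)) (y /ℕ p) (z /ℕ p) (+ p))
      where
      lemma : ∀ r s t u v → (r ℤ.+ t ℤ.* v) ℤ.- (s ℤ.+ u ℤ.* v) ≡ (r ℤ.- s) ℤ.+ (t ℤ.- u) ℤ.* v
      lemma = solve-∀

  residue-injective : ∀ {y z} → residue y ≡ residue z → _≡ₙ_ p y z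
  residue-injective {y} {z} eq = divides (y /ℕ p ℤ.- z /ℕ p) (begin
    y ℤ.- z                                                          ≡⟨ difference y z ⟩
    (+ (y %ℕ p) ℤ.- + (z %ℕ p)) ℤ.+ (y /ℕ p ℤ.- z /ℕ p) ℤ.* + p     ≡⟨ ≡.cong (ℤ._+ (y /ℕ p ℤ.- z /ℕ p) ℤ.* + p)
                                                                          (ℤ.i≡j⇒i-j≡0 (≡.cong +_ (Fin.fromℕ<-injective _ _ _ _ eq))) ⟩
    0ℤ ℤ.+ (y /ℕ p ℤ.- z /ℕ p) ℤ.* + p                               ≡⟨ ℤ.+-identityˡ _ ⟩
    (y /ℕ p ℤ.- z /ℕ p) ℤ.* + p                                      ∎)
    where open ≡.≡-Reasoning

  -- Both remainders lie below `p`, so their difference has absolute value below `p`; being a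
  -- multiple of `p`, it is zero.
  residue-cong : ∀ {y z} → _≡ₙ_ p y z → residue y ≡ residue z
  residue-cong {y} {z} (divides t eq) = Fin.fromℕ<-cong r s (ℤ.+-injective (ℤ.i-j≡0⇒i≡j _ _ (ℤ.∣i∣≡0⇒i≡0 (∣d∣≡0 ∣ d ∣ p∣d ∣d∣<p)))) _ _
    where
    r s : ℕ
    r = y %ℕ p
    s = z %ℕ p
    d : ℤ
    d = + r ℤ.- + s

    lemma : ∀ d u v w → d ℤ.+ u ℤ.* v ≡ w ℤ.* v → d ≡ (w ℤ.- u) ℤ.* v
    lemma d u v w eq = begin
      d                               ≡⟨ solve₁ d (u ℤ.* v) ⟩
      (d ℤ.+ u ℤ.* v) ℤ.- u ℤ.* v    ≡⟨ ≡.cong (ℤ._- u ℤ.* v) eq ⟩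
      w ℤ.* v ℤ.- u ℤ.* v            ≡⟨ solve₂ w u v ⟩
      (w ℤ.- u) ℤ.* v                ∎
      where
      open ≡.≡-Reasoning
      solve₁ : ∀ d e → d ≡ (d ℤ.+ e) ℤ.- e
      solve₁ = solve-∀
      solve₂ : ∀ w u v → w ℤ.* v ℤ.- u ℤ.* v ≡ (w ℤ.- u) ℤ.* v
      solve₂ = solve-∀

    p∣d : p ℕ.∣ ∣ d ∣
    p∣d = ∣⇒∣ᵤ (divides (t ℤ.- (y /ℕ p ℤ.- z /ℕ p))
      (lemma d (y /ℕ p ℤ.- z /ℕ p) (+ p) t (≡.trans (≡.sym (difference y z)) eq)))

    ∣d∣<p : ∣ d ∣ ℕ.< p
    ∣d∣<p = ℕ.≤-<-trans
      (≡.subst (ℕ._≤ r ℕ.⊔ s) (≡.cong ∣_∣ (≡.sym (ℤ.m-n≡m⊖n r s))) (ℤ.∣m⊝n∣≤m⊔n r s))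
      (ℕ.⊔-lub (n%ℕd<d y p) (n%ℕd<d z p))

    ∣d∣≡0 : ∀ n → p ℕ.∣ n → n ℕ.< p → n ≡ 0
    ∣d∣≡0 zero    _   _   = ≡.refl
    ∣d∣≡0 (suc n) p∣n n<p = contradiction p∣n (ℕ.>⇒∤ n<p)

  residue-toℕ : ∀ (r : Residue) → residue (+ toℕ r) ≡ r
  residue-toℕ r = ≡.trans
    (Fin.fromℕ<-cong _ _ (ℕ.m<n⇒m%n≡m (Fin.toℕ<n r)) _ (Fin.toℕ<n r))
    (Fin.fromℕ<-toℕ r (Fin.toℕ<n r))

  isNonzero-residue : ∀ z → isNonzero (residue z) ≡ false ⇔ + p ∣ z
  isNonzero-residue z = mk⇔
    (λ eq → ≡.subst (+ p ∣_) (ℤ.+-identityʳ z) (residue-injective {z} {0ℤ} (isZero (residue z) eq)))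
    (λ p∣z → ≡.cong isNonzero (residue-cong {z} {0ℤ} (≡.subst (+ p ∣_) (≡.sym (ℤ.+-identityʳ z)) p∣z)))
    where
    isZero : ∀ (r : Residue) → isNonzero r ≡ false → r ≡ zero
    isZero zero _ = ≡.refl

  -- Euclid's lemma excludes a zero product of nonzero residues. Here primality makes supports
  -- multiplicative, and hence adjacency a matter of supports alone.
  isNonzero-* : Prime p → ∀ y z → isNonzero (residue (y ℤ.* z)) ≡ isNonzero (residue y) ∧ isNonzero (residue z)
  isNonzero-* pr y z
    with isNonzero (residue y) in eqy | isNonzero (residue z) in eqz | isNonzero (residue (y ℤ.* z)) in eqyz
  ... | false | _     | false = ≡.refl
  ... | true  | false | false = ≡.refl
  ... | true  | true  | true  = ≡.refl
  ... | false | _     | true  = contradiction (≡.trans (≡.sym eqyz)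
        (Equivalence.from (isNonzero-residue (y ℤ.* z)) (∣m⇒∣m*n z (Equivalence.to (isNonzero-residue y) eqy)))) (λ ())
  ... | true  | false | true  = contradiction (≡.trans (≡.sym eqyz)
        (Equivalence.from (isNonzero-residue (y ℤ.* z)) (∣n⇒∣m*n y (Equivalence.to (isNonzero-residue z) eqz)))) (λ ())
  ... | true  | true  | false = contradiction p∣y⊎p∣z λ
    { (inj₁ p∣y) → contradiction (≡.trans (≡.sym eqy) (Equivalence.from (isNonzero-residue y) (∣ᵤ⇒∣ p∣y))) (λ ())
    ; (inj₂ p∣z) → contradiction (≡.trans (≡.sym eqz) (Equivalence.from (isNonzero-residue z) (∣ᵤ⇒∣ p∣z))) (λ ()) }
    where
    p∣y⊎p∣z : p ℕ.∣ ∣ y ∣ ⊎ p ℕ.∣ ∣ z ∣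
    p∣y⊎p∣z = euclidsLemma ∣ y ∣ ∣ z ∣ pr
      (≡.subst (p ℕ.∣_) (ℤ.abs-* y z) (∣⇒∣ᵤ (Equivalence.to (isNonzero-residue (y ℤ.* z)) eqyz)))

  Code : Set
  Code = Residue × Residue × Residue

  support : Code → Support
  support (r , s , t) = isNonzero r , isNonzero s , isNonzero t

  residuesOf : Bool → List Residue
  residuesOf false = zero ∷ []
  residuesOf true  = map suc (allFin q)

  block : Support → List Code
  block (a , b , c) = cartesianProduct (residuesOf a) (cartesianProduct (residuesOf b) (residuesOf c))

  -- The canonical vertex list, grouped by support so that twins stand together as `listDet-absorb`
  -- requires.
  properCodes : List Code
  properCodes = concatMap (block ∘ properSupport) (allFin 6)

  ∈-residuesOf⁺ : ∀ r → r ∈ residuesOf (isNonzero r)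
  ∈-residuesOf⁺ zero    = here ≡.refl
  ∈-residuesOf⁺ (suc r) = ∈-map⁺ suc (∈-allFin r)

  ∈-residuesOf⁻ : ∀ b {r} → r ∈ residuesOf b → isNonzero r ≡ b
  ∈-residuesOf⁻ false (here ≡.refl) = ≡.refl
  ∈-residuesOf⁻ true  r∈ with _ , _ , ≡.refl ← ∈-map⁻ suc r∈ = ≡.refl

  ∈-block⁺ : ∀ z → z ∈ block (support z)
  ∈-block⁺ (r , s , t) =
    ∈-cartesianProduct⁺ (∈-residuesOf⁺ r) (∈-cartesianProduct⁺ (∈-residuesOf⁺ s) (∈-residuesOf⁺ t))

  ∈-block⁻ : ∀ s {z} → z ∈ block s → support z ≡ s
  ∈-block⁻ (a , b , c) z∈ =
    let r∈ , st∈ = ∈-cartesianProduct⁻ (residuesOf a) _ z∈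
        s∈ , t∈  = ∈-cartesianProduct⁻ (residuesOf b) _ st∈
    in ≡.cong₂ _,_ (∈-residuesOf⁻ a r∈) (≡.cong₂ _,_ (∈-residuesOf⁻ b s∈) (∈-residuesOf⁻ c t∈))

  ∈-properCodes⁺ : ∀ z → Proper (support z) → z ∈ properCodes
  ∈-properCodes⁺ z pr = lemma pr (∈-block⁺ z)
    where
    lemma : ∀ {s} → Proper s → z ∈ block s → z ∈ properCodes
    lemma (proper i) z∈ = ∈-concat⁺′ z∈ (∈-map⁺ (block ∘ properSupport) (∈-allFin i))

  ∈-properCodes⁻ : ∀ {z} → z ∈ properCodes → Proper (support z)
  ∈-properCodes⁻ {z} z∈
    with _ , z∈b , b∈ ← ∈-concat⁻′ (map (block ∘ properSupport) (allFin 6)) z∈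
    with i , _ , ≡.refl ← ∈-map⁻ (block ∘ properSupport) {xs = allFin 6} b∈
    = ≡.subst Proper (≡.sym (∈-block⁻ (properSupport i) z∈b)) (proper i)

  residuesOf-unique : ∀ b → Unique (residuesOf b)
  residuesOf-unique false = All.[] AllPairs.∷ AllPairs.[]
  residuesOf-unique true  = Unique.map⁺ Fin.suc-injective (Unique.allFin⁺ q)

  block-unique : ∀ s → Unique (block s)
  block-unique (a , b , c) = Unique.cartesianProduct⁺ (residuesOf-unique a)
    (Unique.cartesianProduct⁺ (residuesOf-unique b) (residuesOf-unique c))

  properCodes-unique : Unique properCodes
  properCodes-unique = Unique.concat⁺
    (All.map⁺ (All.universal (block-unique ∘ properSupport) (allFin 6)))
    (AllPairs.map⁺ (AllPairs.map blocks-disjoint (Unique.allFin⁺ 6)))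
    where
    blocks-disjoint : ∀ {i j} → i ≢ j → Disjoint (block (properSupport i)) (block (properSupport j))
    blocks-disjoint {i} {j} i≢j (z∈i , z∈j) = i≢j (properSupport-injective i j
      (≡.trans (≡.sym (∈-block⁻ (properSupport i) z∈i)) (∈-block⁻ (properSupport j) z∈j)))

  size : Bool → ℕ
  size false = 1
  size true  = q

  blockSize : Support → ℕ
  blockSize (a , b , c) = size a ℕ.* (size b ℕ.* size c)

  length-residuesOf : ∀ b → length (residuesOf b) ≡ size b
  length-residuesOf false = ≡.refl
  length-residuesOf true  = ≡.trans (List.length-map suc (allFin q)) (List.length-tabulate id)

  length-block : ∀ i → length (block (properSupport i)) ≡ properWeight q (q ℕ.* q) i
  length-block i = ≡.trans (general (properSupport i)) (evaluate i)
    where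
    general : ∀ s → length (block s) ≡ blockSize s
    general (a , b , c) = ≡.trans
      (length-cartesianProduct (residuesOf a) _)
      (≡.cong₂ ℕ._*_ (length-residuesOf a) (≡.trans
        (length-cartesianProduct (residuesOf b) (residuesOf c))
        (≡.cong₂ ℕ._*_ (length-residuesOf b) (length-residuesOf c))))

    evaluate : ∀ i → blockSize (properSupport i) ≡ properWeight q (q ℕ.* q) i
    evaluate 0F = ℕ.*-identityʳ q
    evaluate 1F = ≡.trans (ℕ.*-identityˡ _) (ℕ.*-identityʳ q)
    evaluate 2F = ≡.trans (ℕ.*-identityˡ _) (ℕ.*-identityˡ q)
    evaluate 3F = ℕ.*-identityˡ _
    evaluate 4F = ≡.cong (q ℕ.*_) (ℕ.*-identityˡ q)
    evaluate 5F = ≡.cong (q ℕ.*_) (ℕ.*-identityʳ q)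

-- Zero-divisors of the ring in terms of supports

module CubeOfPrimeField {c ℓ} (R : FiniteCommutativeRing c ℓ) (m : ℕ)
  (pr : Prime (suc (suc m)))
  (iso : FiniteCommutativeRing.commutativeRing R ≅
         ℤ/ (suc (suc m)) ⊗ ℤ/ (suc (suc m)) ⊗ ℤ/ (suc (suc m))) where
  open FiniteCommutativeRing R hiding (zero)
  open Residues (suc m)
  private
    module S = CommutativeRing (ℤ/ p ⊗ ℤ/ p ⊗ ℤ/ p)
  open RingMorphisms (CommutativeRing.rawRing commutativeRing) S.rawRing
  private
    f : Carrier → S.Carrier
    f = proj₁ iso
    module f = IsRingIsomorphism (proj₂ iso)

  codeℤ : S.Carrier → Code
  codeℤ (x , y , z) = residue x , residue y , residue z

  codeℤ-cong : ∀ x y → x S.≈ y → codeℤ x ≡ codeℤ y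
  codeℤ-cong (x , y , z) (x′ , y′ , z′) (x≡x′ , y≡y′ , z≡z′) = ≡.cong₂ _,_
    (residue-cong {x} {x′} x≡x′)
    (≡.cong₂ _,_ (residue-cong {y} {y′} y≡y′) (residue-cong {z} {z′} z≡z′))

  codeℤ-injective : ∀ x y → codeℤ x ≡ codeℤ y → x S.≈ y
  codeℤ-injective (x , y , z) (x′ , y′ , z′) eq =
    residue-injective {x} {x′} (≡.cong proj₁ eq) ,
    residue-injective {y} {y′} (≡.cong (proj₁ ∘ proj₂) eq) ,
    residue-injective {z} {z′} (≡.cong (proj₂ ∘ proj₂) eq)

  code : Carrier → Code
  code x = codeℤ (f x)

  supp : Carrier → Support
  supp x = support (code x)

  code-cong : ∀ {x y} → x ≈ y → code x ≡ code y
  code-cong {x} {y} x≈y = codeℤ-cong (f x) (f y) (f.⟦⟧-cong x≈y)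

  code-injective : ∀ {x y} → code x ≡ code y → x ≈ y
  code-injective {x} {y} eq = f.injective (codeℤ-injective (f x) (f y) eq)

  code-surjective : ∀ z → ∃[ x ] code x ≡ z
  code-surjective (r , s , t) =
    let y       = + toℕ r , + toℕ s , + toℕ t
        x , fx≈ = f.surjective y
    in x , ≡.trans (codeℤ-cong (f x) y (fx≈ refl))
             (≡.cong₂ _,_ (residue-toℕ r) (≡.cong₂ _,_ (residue-toℕ s) (residue-toℕ t)))

  code-0 : code 0# ≡ (zero , zero , zero)
  code-0 = codeℤ-cong (f 0#) S.0# f.0#-homo

  supp≡empty⇔≈0 : ∀ x → supp x ≡ empty ⇔ x ≈ 0#
  supp≡empty⇔≈0 x = mk⇔
    (λ eq → code-injective (≡.trans (unsupported (code x) eq) (≡.sym code-0)))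
    (λ x≈0 → ≡.cong support (≡.trans (code-cong x≈0) code-0))
    where
    unsupported : ∀ z → support z ≡ empty → z ≡ (zero , zero , zero)
    unsupported (zero , zero , zero) _ = ≡.refl

  supp-* : ∀ x y → supp (x * y) ≡ supp x ∩ supp y
  supp-* x y = ≡.trans (≡.cong support (codeℤ-cong (f (x * y)) (f x S.* f y) (f.*-homo x y)))
    (multiplicative (f x) (f y))
    where
    multiplicative : ∀ x y → support (codeℤ (x S.* y)) ≡ support (codeℤ x) ∩ support (codeℤ y)
    multiplicative (x , y , z) (x′ , y′ , z′) =
      ≡.cong₂ _,_ (isNonzero-* pr x x′) (≡.cong₂ _,_ (isNonzero-* pr y y′) (isNonzero-* pr z z′))

  ∩-empty⇔*≈0 : ∀ x y → supp x ∩ supp y ≡ empty ⇔ x * y ≈ 0#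
  ∩-empty⇔*≈0 x y = ≡.subst (λ s → s ≡ empty ⇔ x * y ≈ 0#) (supp-* x y) (supp≡empty⇔≈0 (x * y))

  -- The adjacency matrix reads only the Boolean `does` of the decision, so an equation of Booleans
  -- is enough to rewrite its entries.
  adjacent≡disjoint : ∀ x y → does (x * y ≟ 0#) ≡ disjoint (supp x) (supp y)
  adjacent≡disjoint x y with disjoint (supp x) (supp y) in eq
  ... | true  = dec-true (x * y ≟ 0#)
    (Equivalence.to (∩-empty⇔*≈0 x y) (Equivalence.to (disjoint⇔∩-empty (supp x) (supp y)) eq))
  ... | false = dec-false (x * y ≟ 0#) λ xy≈0 → contradiction
    (≡.trans (≡.sym (Equivalence.from (disjoint⇔∩-empty (supp x) (supp y))
      (Equivalence.from (∩-empty⇔*≈0 x y) xy≈0))) eq) (λ ())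

  supp-surjective : ∀ s → ∃[ x ] supp x ≡ s
  supp-surjective (a , b , c) =
    let x , eq = code-surjective (indicator a , indicator b , indicator c)
    in x , ≡.trans (≡.cong support eq)
             (≡.cong₂ _,_ (isNonzero-indicator a) (≡.cong₂ _,_ (isNonzero-indicator b) (isNonzero-indicator c)))
    where
    indicator : Bool → Residue
    indicator false = zero
    -- A second residue exists because `p` is `suc (suc m)`.
    indicator true  = suc zero

    isNonzero-indicator : ∀ b → isNonzero (indicator b) ≡ b
    isNonzero-indicator false = ≡.refl
    isNonzero-indicator true  = ≡.refl

  zeroDivisor⇒proper : ∀ x → ¬ x ≈ 0# → IsZeroDivisor R x → Proper (supp x)
  zeroDivisor⇒proper x x≉0 (y , y≉0 , xy≈0) = disjoint⇒proper (supp x) (supp y)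
    (Equivalence.from (∩-empty⇔*≈0 x y) xy≈0)
    (x≉0 ∘ Equivalence.to (supp≡empty⇔≈0 x))
    (y≉0 ∘ Equivalence.to (supp≡empty⇔≈0 y))

  proper⇒zeroDivisor : ∀ x → Proper (supp x) → ¬ x ≈ 0# × IsZeroDivisor R x
  proper⇒zeroDivisor x pr =
    let s≢∅ , t , t≢∅ , s∩t≡∅ = proper⇒disjoint pr
        y , suppy≡t = supp-surjective t
    in s≢∅ ∘ Equivalence.from (supp≡empty⇔≈0 x) ,
       y ,
       (λ y≈0 → t≢∅ (≡.trans (≡.sym suppy≡t) (Equivalence.from (supp≡empty⇔≈0 y) y≈0))) ,
       Equivalence.to (∩-empty⇔*≈0 x y) (≡.trans (≡.cong (supp x ∩_) suppy≡t) s∩t≡∅)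

  vertices : List Carrier
  vertices = nonzeroZeroDivisors R

  private
    IsVertex : Carrier → Set _
    IsVertex x = ¬ x ≈ 0# × IsZeroDivisor R x

    isVertex? : ∀ x → Dec (IsVertex x)
    isVertex? x = ¬? (x ≟ 0#) ×-dec isZeroDivisor? R x

    IsVertex-resp-≈ : ∀ {x y} → x ≈ y → IsVertex x → IsVertex y
    IsVertex-resp-≈ x≈y (x≉0 , z , z≉0 , xz≈0) =
      x≉0 ∘ trans x≈y , z , z≉0 , trans (*-congʳ (sym x≈y)) xz≈0

  -- Duplicate-free lists with the same members are permutations of each other. Uniqueness passes
  -- from `elements` to the codes because `code` is injective; the members agree because the nonzero
  -- zero-divisors are exactly the elements of proper support.
  codes↭properCodes : map code vertices ↭ properCodes
  codes↭properCodes = ∼bag⇒↭ (unique∧set⇒bag codes-unique properCodes-unique (mk⇔ to from))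
    where
    codes-unique : Unique (map code vertices)
    codes-unique = SetoidUnique.map⁺ setoid (≡.setoid Code) code-injective
      (SetoidUnique.filter⁺ setoid isVertex? unique)

    to : ∀ {z} → z ∈ map code vertices → z ∈ properCodes
    to z∈ with x , x∈ , ≡.refl ← SetoidMembership.∈-map⁻ setoid (≡.setoid Code) z∈
      with _ , x≉0 , zd ← SetoidMembership.∈-filter⁻ setoid isVertex? IsVertex-resp-≈ {xs = elements} x∈
      = ∈-properCodes⁺ (code x) (zeroDivisor⇒proper x x≉0 zd)

    from : ∀ {z} → z ∈ properCodes → z ∈ map code vertices
    from {z} z∈ with x , ≡.refl ← code-surjective z =
      SetoidMembership.∈-map⁺ setoid (≡.setoid Code) code-cong
        (SetoidMembership.∈-filter⁺ setoid isVertex? IsVertex-resp-≈ (enumeration x)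
          (proper⇒zeroDivisor x (∈-properCodes⁻ z∈)))

-- The characteristic polynomial of the zero-divisor graph

map-constantOn : {A : Set a} {B : Set b} (f : A → B) {y : B} (xs : List A) →
                 (∀ {x} → x ∈ xs → f x ≡ y) → map f xs ≡ replicate (length xs) y
map-constantOn f []       f≡y = ≡.refl
map-constantOn f (x ∷ xs) f≡y = ≡.cong₂ _∷_ (f≡y (here ≡.refl)) (map-constantOn f xs (f≡y ∘ there))

module ProperClasses (m : ℕ) where
  q : ℕ
  q = suc m

  -- One less than the number of codes with the given support.
  multiplicity : Fin 6 → ℕ
  multiplicity = properWeight m (m ℕ.+ m ℕ.* suc m)

  classes : List (Support × ℕ)
  classes = map (λ i → properSupport i , multiplicity i) (allFin 6)

  -- A block of size s yields s - 1 factors x, and 3(q - 1) + 3(q² - 1) = 3(q + 2)(q - 1), where q +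
  -- 2 = p + 1 and q - 1 = p - 2 = m.
  sum-multiplicities : sumℕ (map proj₂ classes) ≡ 3 ℕ.* (suc (suc m) ℕ.+ 1) ℕ.* m
  sum-multiplicities = lemma m
    where
    lemma : ∀ m → let n = m ℕ.+ m ℕ.* suc m in
            m ℕ.+ (m ℕ.+ (m ℕ.+ (n ℕ.+ (n ℕ.+ (n ℕ.+ 0))))) ≡ 3 ℕ.* (suc (suc m) ℕ.+ 1) ℕ.* m
    lemma = solveℕ-∀

module _ (K : CommutativeRing k ℓ₁) {c ℓ} (R : FiniteCommutativeRing c ℓ) (m : ℕ)
  (pr : Prime (suc (suc m)))
  (iso : FiniteCommutativeRing.commutativeRing R ≅
         ℤ/ (suc (suc m)) ⊗ ℤ/ (suc (suc m)) ⊗ ℤ/ (suc (suc m))) where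
  private
    module R = FiniteCommutativeRing R
  open ProperClasses m
  open CubeOfPrimeField R m pr iso using (vertices; code; supp; adjacent≡disjoint; codes↭properCodes)
  open Residues q using (Code; support; block; properCodes; ∈-block⁻; length-block)
  open CommutativeRing K hiding (zero)
  open RawSemiringDefs (Semiring.rawSemiring semiring) using (_^_) renaming (_×_ to _×ℕ_)
  open Determinant K using (det-cong)

  private
    adjacency : Matrix K (length vertices)
    adjacency i j = if does (lookup vertices i R.* lookup vertices j R.≟ R.0#) then 1# else 0#

  module _ (x : Carrier) where
    open WeightedCharPoly K (disjointness K) x
    open SetoidReasoning setoid

    weighted : Code → Support × Carrier
    weighted z = support z , 1#

    map-weighted-block : ∀ i → map weighted (block (properSupport i))
                             ≡ replicate (suc (multiplicity i)) (properSupport i , 1#)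
    map-weighted-block i = ≡.trans
      (map-constantOn weighted (block (properSupport i)) (≡.cong (_, 1#) ∘ ∈-block⁻ (properSupport i)))
      (≡.cong (λ n → replicate n (properSupport i , 1#)) (≡.trans (length-block i) (suc-multiplicity i)))
      where
      -- `q * q` computes to `suc (m + m * suc m)`, so all six cases are definitional.
      suc-multiplicity : ∀ i → properWeight q (q ℕ.* q) i ≡ suc (multiplicity i)
      suc-multiplicity 0F = ≡.refl
      suc-multiplicity 1F = ≡.refl
      suc-multiplicity 2F = ≡.refl
      suc-multiplicity 3F = ≡.refl
      suc-multiplicity 4F = ≡.refl
      suc-multiplicity 5F = ≡.refl

    map-weighted-properCodes : map weighted properCodes ≡ blocks classes
    map-weighted-properCodes = ≡.trans
      (List.map-concatMap weighted (block ∘ properSupport) (allFin 6))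
      (List.concatMap-cong map-weighted-block (allFin 6))

    charPoly-vertices : charPoly K adjacency x ≈ listDet (map weighted (map code vertices))
    charPoly-vertices = begin
      charPoly K adjacency x
        ≈⟨ det-cong (λ i j → +-congˡ (-‿cong (trans
             (reflexive (≡.cong (if_then 1# else 0#) (adjacent≡disjoint (lookup vertices i) (lookup vertices j))))
             (sym (*-identityˡ _))))) ⟩
      weightedDet (supp ∘ lookup vertices) (const 1#)
        ≈⟨ listDet-map h vertices ⟨
      listDet (map h vertices)
        ≡⟨ ≡.cong listDet (List.map-∘ vertices) ⟩
      listDet (map weighted (map code vertices)) ∎
      where
      h : R.Carrier → Support × Carrier
      h = weighted ∘ code

    charPoly-Γ : charPoly K adjacency x ≈
                 x ^ (3 ℕ.* (suc q ℕ.+ 1) ℕ.* m) * sextic K x (q ×ℕ 1#) ((q ℕ.* q) ×ℕ 1#)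
    charPoly-Γ = begin
      charPoly K adjacency x
        ≈⟨ charPoly-vertices ⟩
      listDet (map weighted (map code vertices))
        ≈⟨ listDet-↭ (↭-map⁺ weighted codes↭properCodes) ⟩
      listDet (map weighted properCodes)
        ≡⟨ ≡.cong listDet map-weighted-properCodes ⟩
      listDet (blocks classes)
        ≈⟨ listDet-blocks classes ⟩
      x ^ sumℕ (map proj₂ classes) * listDet (weights classes)
        -- The list of merged vertices is turned into families on `Fin 6`, the form that `properDet`
        -- speaks of.
        ≈⟨ *-cong (reflexive (≡.cong (x ^_) sum-multiplicities)) (weightedDet-cong
             {cls = proj₁ ∘ lookup (weights classes)} {properSupport}
             {proj₂ ∘ lookup (weights classes)} {properWeight Q S} cls≗ w≈) ⟩
      x ^ (3 ℕ.* (suc q ℕ.+ 1) ℕ.* m) * weightedDet properSupport (properWeight Q S)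
        ≈⟨ *-congˡ (properDet K x Q S) ⟩
      x ^ (3 ℕ.* (suc q ℕ.+ 1) ℕ.* m) * sextic K x Q S ∎
      where
      Q = q ×ℕ 1#
      S = (q ℕ.* q) ×ℕ 1#

      cls≗ : ∀ i → proj₁ (lookup (weights classes) i) ≡ properSupport i
      cls≗ 0F = ≡.refl
      cls≗ 1F = ≡.refl
      cls≗ 2F = ≡.refl
      cls≗ 3F = ≡.refl
      cls≗ 4F = ≡.refl
      cls≗ 5F = ≡.refl

      w≈ : ∀ i → proj₂ (lookup (weights classes) i) ≈ properWeight Q S i
      w≈ 0F = refl
      w≈ 1F = refl
      w≈ 2F = refl
      w≈ 3F = refl
      w≈ 4F = refl
      w≈ 5F = refl

-- The eigenvalues as roots of the two quadratics

module Eigenvalues (K : EuclideanField k ℓ₁ ℓ₂ ℓ₃) where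
  open EuclideanField K
  open IntegerSolver commutativeRing
  open RingProperties ring using (-0#≈0#)
  open SemiringMult semiring using (×1-homo-*)
  open SetoidReasoning setoid

  fromℕ-nonNegative : ∀ n → 0# ≤ fromℕ n
  fromℕ-nonNegative zero    n<0 = <.irrefl refl n<0
  fromℕ-nonNegative (suc n) n<0 = <.irrefl refl (<.trans (positive n) n<0)
    where
    positive : ∀ n → 0# < fromℕ (suc n)
    positive zero    = <.<-respʳ-≈ (sym (+-identityʳ 1#)) 0<1
    positive (suc n) = <.trans 0<1
      (<.<-respˡ-≈ (+-identityʳ 1#) (+-monoʳ-< 1# (positive n)))

  -- `√` is specified at non-negative arguments only. The radicands contain subtractions, and they
  -- get their sign by being identified with images of natural numbers: 4p - 3 = 1 + 4q and p - 2p²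
  -- + p³ = pq².
  √-square′ : ∀ n {y} → y ≈ fromℕ n → √ y * √ y ≈ y
  √-square′ n y≈n = √-square λ y<0 → fromℕ-nonNegative n (<.<-respˡ-≈ y≈n y<0)

  module _ (m : ℕ) (x : Carrier) where
    private
      q : ℕ
      q = suc m
      Q P D E : Carrier
      Q = fromℕ q
      P = fromℕ (suc q)
      D = fromℕ 4 * P - fromℕ 3
      E = (P - fromℕ 2 * P ^ 2) + P ^ 3

      D≈ : D ≈ fromℕ (1 ℕ.+ 4 ℕ.* q)
      D≈ = begin
        D                 ≈⟨ solve 1 (λ Q → :4 :* (1ₚ :+ Q) :- :3 := 1ₚ :+ :4 :* Q) refl Q ⟩
        1# + fromℕ 4 * Q  ≈⟨ +-congˡ (×1-homo-* 4 q) ⟨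
        fromℕ (1 ℕ.+ 4 ℕ.* q) ∎
        where
        :3 :4 : Polynomial 1
        -- Written the way `fromℕ` unfolds, so that the equation read by the solver is
        -- definitionally the goal. For the same reason `P` enters as `1ₚ :+ Q`.
        :3 = 1ₚ :+ (1ₚ :+ (1ₚ :+ 0ₚ))
        :4 = 1ₚ :+ :3

      E≈PQQ : E ≈ P * (Q * Q)
      E≈PQQ = solve 1 (λ Q → let P = 1ₚ :+ Q in
        (P :- (1ₚ :+ (1ₚ :+ 0ₚ)) :* (P :* (P :* 1ₚ))) :+ P :* (P :* (P :* 1ₚ)) := P :* (Q :* Q)) refl Q

      E≈ : E ≈ fromℕ (suc q ℕ.* (q ℕ.* q))
      E≈ = begin
        E                              ≈⟨ E≈PQQ ⟩
        P * (Q * Q)                    ≈⟨ *-congˡ (×1-homo-* q q) ⟨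
        P * fromℕ (q ℕ.* q)            ≈⟨ ×1-homo-* (suc q) (q ℕ.* q) ⟨
        fromℕ (suc q ℕ.* (q ℕ.* q))    ∎

    λ₁ λ₂ λ₃ λ₄ : Carrier
    λ₁ = ½ * ((1# - P) + (P - 1#) * √ D)
    λ₂ = ½ * ((1# - P) - (P - 1#) * √ D)
    λ₃ = (P - 1#) + √ E
    λ₄ = (P - 1#) - √ E

    -- The two roots have sum -q and product ¼(q² - q²(4q + 1)) = -q³.
    λ₁λ₂-factor : (x - λ₁) * (x - λ₂) ≈ x * x + Q * x - Q * (Q * Q)
    λ₁λ₂-factor = begin
      (x - λ₁) * (x - λ₂)
        -- To the solver ½ is a plain variable, so the factors `h :* :2` are kept together until
        -- `½*2≈1` removes them.
        ≈⟨ solve 4 (λ x h Q s → let P = 1ₚ :+ Q in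
             (x :- h :* ((1ₚ :- P) :+ (P :- 1ₚ) :* s)) :* (x :- h :* ((1ₚ :- P) :- (P :- 1ₚ) :* s))
             := x :* x :+ (h :* :2) :* Q :* x :+ h :* h :* (Q :* Q :- Q :* Q :* (s :* s)))
             refl x ½ Q (√ D) ⟩
      x * x + ½ * fromℕ 2 * Q * x + ½ * ½ * (Q * Q - Q * Q * (√ D * √ D))
        ≈⟨ +-congˡ (*-congˡ (+-congˡ (-‿cong (*-congˡ (√-square′ (1 ℕ.+ 4 ℕ.* q) D≈))))) ⟩
      x * x + ½ * fromℕ 2 * Q * x + ½ * ½ * (Q * Q - Q * Q * D)
        -- The identity 1 - D = -4Q supplies one factor 2 for each of the two factors ½.
        ≈⟨ solve 3 (λ x h Q → let P = 1ₚ :+ Q in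
             x :* x :+ (h :* :2) :* Q :* x
               :+ h :* h :* (Q :* Q :- Q :* Q :* ((1ₚ :+ (1ₚ :+ :2)) :* P :- (1ₚ :+ :2)))
             := x :* x :+ (h :* :2) :* Q :* x :- (h :* :2) :* (h :* :2) :* (Q :* (Q :* Q)))
             refl x ½ Q ⟩
      x * x + ½ * fromℕ 2 * Q * x - ½ * fromℕ 2 * (½ * fromℕ 2) * (Q * (Q * Q))
        ≈⟨ +-cong (+-congˡ (*-congʳ (*-congʳ ½*2≈1))) (-‿cong (*-congʳ (*-cong ½*2≈1 ½*2≈1))) ⟩
      x * x + 1# * Q * x - 1# * 1# * (Q * (Q * Q))
        ≈⟨ solve 2 (λ x Q → x :* x :+ 1ₚ :* Q :* x :- 1ₚ :* 1ₚ :* (Q :* (Q :* Q))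
             := x :* x :+ Q :* x :- Q :* (Q :* Q)) refl x Q ⟩
      x * x + Q * x - Q * (Q * Q) ∎
      where
      :2 : ∀ {n} → Polynomial n
      :2 = 1ₚ :+ (1ₚ :+ 0ₚ)

    -- The two roots have sum 2q and product q² - pq² = -q³.
    λ₃λ₄-factor : (x - λ₃) * (x - λ₄) ≈ x * x - (Q + Q) * x - Q * (Q * Q)
    λ₃λ₄-factor = begin
      (x - λ₃) * (x - λ₄)
        ≈⟨ solve 3 (λ x Q t → let P = 1ₚ :+ Q in
             (x :- ((P :- 1ₚ) :+ t)) :* (x :- ((P :- 1ₚ) :- t))
             := x :* x :- (Q :+ Q) :* x :+ (Q :* Q :- t :* t)) refl x Q (√ E) ⟩
      x * x - (Q + Q) * x + (Q * Q - √ E * √ E)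
        ≈⟨ +-congˡ (+-congˡ (-‿cong (trans (√-square′ (suc q ℕ.* (q ℕ.* q)) E≈) E≈PQQ))) ⟩
      x * x - (Q + Q) * x + (Q * Q - P * (Q * Q))
        ≈⟨ solve 2 (λ x Q → x :* x :- (Q :+ Q) :* x :+ (Q :* Q :- (1ₚ :+ Q) :* (Q :* Q))
             := x :* x :- (Q :+ Q) :* x :- Q :* (Q :* Q)) refl x Q ⟩
      x * x - (Q + Q) * x - Q * (Q * Q) ∎

    zeros-factor : ∀ n → foldr _*_ 1# (map (λ a → x - a) (replicate n 0#)) ≈ x ^ n
    zeros-factor zero    = refl
    zeros-factor (suc n) = *-cong (trans (+-congˡ -0#≈0#) (+-identityʳ x)) (zeros-factor n)

    spectrum-product : ∀ n →
      x ^ n * sextic commutativeRing x Q (fromℕ (q ℕ.* q)) ≈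
        foldr _*_ 1# (map (λ a → x - a)
          (replicate 2 λ₁ ++ replicate 2 λ₂ ++ replicate 1 λ₃ ++ replicate 1 λ₄ ++ replicate n 0#))
    spectrum-product n = begin
      x ^ n * (B * (A * A))
        ≈⟨ *-cong (sym (zeros-factor n)) (*-cong
             (trans (+-congˡ (-‿cong QS≈)) (sym λ₃λ₄-factor))
             (*-cong (trans (+-congˡ (-‿cong QS≈)) (sym λ₁λ₂-factor))
                     (trans (+-congˡ (-‿cong QS≈)) (sym λ₁λ₂-factor)))) ⟩
      Z * ((x - λ₃) * (x - λ₄) * ((x - λ₁) * (x - λ₂) * ((x - λ₁) * (x - λ₂))))
        ≈⟨ solve 5 (λ z a b c d → z :* (c :* d :* (a :* b :* (a :* b)))
             := a :* (a :* (b :* (b :* (c :* (d :* z))))))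
             refl Z (x - λ₁) (x - λ₂) (x - λ₃) (x - λ₄) ⟩
      (x - λ₁) * ((x - λ₁) * ((x - λ₂) * ((x - λ₂) * ((x - λ₃) * ((x - λ₄) * Z))))) ∎
      where
      S A B Z : Carrier
      S = fromℕ (q ℕ.* q)
      A = x * x + Q * x - Q * S
      B = x * x - (Q + Q) * x - Q * S
      Z = foldr _*_ 1# (map (λ a → x - a) (replicate n 0#))

      QS≈ : Q * S ≈ Q * (Q * Q)
      QS≈ = *-congˡ (×1-homo-* q q)

mainTheorem7 : ∀ {c ℓ k ℓ₁ ℓ₂ ℓ₃ : Level}
    (K : EuclideanField k ℓ₁ ℓ₂ ℓ₃)
    (p : ℕ) → Prime p →
    (R : FiniteCommutativeRing c ℓ) →
    FiniteCommutativeRing.commutativeRing R ≅ ℤ/ p ⊗ ℤ/ p ⊗ ℤ/ p →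
    let open EuclideanField K
        open Spectrum K
        P  = fromℕ p
        λ₁ = ½ * ((1# - P) + (P - 1#) * √ (fromℕ 4 * P - fromℕ 3))
        λ₂ = ½ * ((1# - P) - (P - 1#) * √ (fromℕ 4 * P - fromℕ 3))
        λ₃ = (P - 1#) + √ ((P - fromℕ 2 * P ^ 2) + P ^ 3)
        λ₄ = (P - 1#) - √ ((P - fromℕ 2 * P ^ 2) + P ^ 3)
    in HasSpectrum (Γ R)
         (replicate 2 λ₁ ++ replicate 2 λ₂ ++ replicate 1 λ₃ ++ replicate 1 λ₄
           ++ replicate (3 ℕ.* (p ℕ.+ 1) ℕ.* (p ∸ 2)) 0#)
mainTheorem7 K zero          pr R iso x = contradiction (prime⇒nonTrivial pr) λ ()
mainTheorem7 K (suc zero)    pr R iso x = contradiction (prime⇒nonTrivial pr) λ ()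
-- With two successors exposed, `p ∸ 2` computes to `m`, and the expressions of the statement agree
-- definitionally with those of `Eigenvalues`.
mainTheorem7 K (suc (suc m)) pr R iso x = begin
  charPoly commutativeRing (adjacencyMatrix (Γ R)) x
    ≈⟨ charPoly-Γ commutativeRing R m pr iso x ⟩
  x ^ N * sextic commutativeRing x (fromℕ (suc m)) (fromℕ (suc m ℕ.* suc m))
    ≈⟨ spectrum-product m x N ⟩
  foldr _*_ 1# (map (λ a → x - a) (replicate 2 (λ₁ m x) ++ replicate 2 (λ₂ m x)
    ++ replicate 1 (λ₃ m x) ++ replicate 1 (λ₄ m x) ++ replicate N 0#)) ∎
  where
  open EuclideanField K
  open Spectrum K
  open Eigenvalues K
  open SetoidReasoning setoid

  N : ℕ
  N = 3 ℕ.* (suc (suc m) ℕ.+ 1) ℕ.* m
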